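{- Let $n\ge 1$ and $m\ge 0$ be integers and let $r$ be an integer with $0\le r\le m$. Then $$\mathcal Y_n\big(2^{\{r\}},1^{\{m-r\}}\big)=\frac{1}{(r+1)n}\binom{m}{r}\left(\binom{n-1}{m}+(-1)^r\binom{n-1}{m+r+1}\right).$$ That is, the sum of $\mathfrak Z_n(\sigma)$ over all distinct permutations $\sigma$ of the multiset consisting of $r$ copies of $2$ and $m-r$ copies of $1$ equals the right-hand side.
   Context: Let $\zeta_n=e^{2\pi\sqrt{ -1}/n}$. For positive integers $s_1,\dots,s_m$, define $\mathfrak Z_n(s_1,\dots,s_m):=\sum_{1\le i_1<\cdots<i_m\le n-1}\prod_{k=1}^{m}(1-\zeta_n^{i_k})^{ -s_k}$ (equal to $1$ if $m=0$ and to $0$ if $m>n-1$). Define $\mathcal Y_n(s_1,\dots,s_m):=\sum_{\sigma}\mathfrak Z_n(\sigma)$, where $\sigma$ runs over all distinct rearrangements of $(s_1,\dots,s_m)$; $\mathcal Y_n$ of the empty sequence is $1$. Notation: $a^{\{k\}}$ denotes the block $a,\dots,a$ of length $k$. Binomial coefficients $\binom{a}{b}$ are $0$ when $b<0$ or $b>a\ge0$. -}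

module Defs where

open import Algebra.Apartness.Bundles using (HeytingField; HeytingCommutativeRing)
open import Algebra.Bundles using (CommutativeRing; Semiring)
import Algebra.Definitions.RawSemiring as RawSemiringDefs
open import Data.Fin using (Fin; toℕ)
import Data.Fin.Properties as Fin
open import Data.List using (List; []; _∷_; [_]; map; foldr; concatMap; filter; deduplicate; allFin; cartesianProductWith; length; lookup)
import Data.List.Properties as List
open import Data.Nat using (ℕ; zero; suc; _<_; _∸_; NonZero; z<s)
import Data.Nat.Properties as ℕ
open import Data.Product using (proj₁)
open import Data.Vec using (Vec; []; _∷_)
import Data.Vec as Vec
open import Data.Vec.Relation.Unary.Linked using (linked?)
open import Level using (_⊔_)

insertions : ∀ {a} {A : Set a} → A → List A → List (List A)
insertions x []       = [ x ∷ [] ]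
insertions x (y ∷ ys) = (x ∷ y ∷ ys) ∷ map (y ∷_) (insertions x ys)

permutations : ∀ {a} {A : Set a} → List A → List (List A)
permutations []       = [ [] ]
permutations (x ∷ xs) = concatMap (insertions x) (permutations xs)

-- Each rearrangement is listed once, even when s has repeated entries.
distinctRearrangements : List ℕ → List (List ℕ)
distinctRearrangements s = deduplicate (List.≡-dec ℕ._≟_) (permutations s)

tuples : ∀ N m → List (Vec (Fin N) m)
tuples N zero    = [ [] ]
tuples N (suc m) = cartesianProductWith _∷_ (allFin N) (tuples N m)

increasingTuples : ∀ N m → List (Vec (Fin N) m)
increasingTuples N m = filter (linked? Fin._<?_) (tuples N m)

-- The complex numbers with ζ = e^(2πi/n) are replaced by an arbitrary field of
-- characteristic zero with an arbitrary primitive n-th root of unity ζ.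
-- Heyting fields are used, with _#_ in place of _≉_, so that inverses exist
-- constructively; any discrete field is one, with _#_ taken to be _≉_.
module _ {c ℓ₁ ℓ₂} (K : HeytingField c ℓ₁ ℓ₂) where

  open HeytingField K
  open HeytingCommutativeRing heytingCommutativeRing using (commutativeRing)
  open RawSemiringDefs (Semiring.rawSemiring (CommutativeRing.semiring commutativeRing)) using (_×_; _^_; product)

  fromℕ : ℕ → Carrier
  fromℕ k = k × 1#

  power : Carrier → ℕ → Carrier
  power = _^_

  -- The inverse of x - y, not of x.
  inverseOfDifference : ∀ {x y} → x # y → Carrier
  inverseOfDifference x#y = proj₁ (#⇒invertible x#y)

  CharacteristicZero : Set ℓ₂
  CharacteristicZero = ∀ k .{{_ : NonZero k}} → fromℕ k # 0#

  -- 1 / k, as the inverse of k - 0.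
  reciprocal : CharacteristicZero → ∀ k .{{_ : NonZero k}} → Carrier
  reciprocal char0 k = inverseOfDifference (char0 k)

  record IsPrimitiveRoot (n : ℕ) (ζ : Carrier) : Set (ℓ₁ ⊔ ℓ₂) where
    field
      ζⁿ≈1 : ζ ^ n ≈ 1#
      1#ζᵏ : ∀ {k} → 0 < k → k < n → 1# # ζ ^ k

  sumOver : ∀ {a} {A : Set a} → List A → (A → Carrier) → Carrier
  sumOver xs f = foldr _+_ 0# (map f xs)

  module _ {n : ℕ} {ζ : Carrier} (prim : IsPrimitiveRoot n ζ) where

    open IsPrimitiveRoot prim

    -- Fin (n ∸ 1) stands for {1, …, n - 1}: j represents the index i = j + 1,
    -- and the value is (1 - ζ^i)⁻¹.
    inverse1-ζ^ : Fin (n ∸ 1) → Carrier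
    inverse1-ζ^ j = inverseOfDifference (1#ζᵏ {suc (toℕ j)} z<s (ℕ.pred-cancel-< (Fin.toℕ<n j)))

    𝔷 : List ℕ → Carrier
    𝔷 s = sumOver (increasingTuples (n ∸ 1) (length s)) λ i →
            product λ k → inverse1-ζ^ (Vec.lookup i k) ^ lookup s k

    𝒴 : List ℕ → Carrier
    𝒴 s = sumOver (distinctRearrangements s) 𝔷

{-# OPTIONS --safe #-}

-- Put x_i = 1/(1 - ζ^i) for 0 < i < n. Then 𝒴 is the coefficient of t^(m-r) u^r in
-- ∏ (1 + t x_i + u x_i²) = E(a) E(b), where a + b = t, a b = u and E(a) = ∏ (1 + a x_i).
-- Since the -x_i are the roots of (1 + w)^n - w^n, the k-th elementary symmetric function of the x_i
-- is C(n, k+1)/n. The same expansion of E(a) E(b) applied to n variables equal to 1, where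
-- E(a) = (1 + a)^n and the product is (1 + t + u)^n, has the same terms up to an index shift and one
-- extra boundary term; comparing the two evaluates the coefficient without summing anything.
module Submission where

open import Defs
open import Algebra.Apartness.Bundles using (HeytingCommutativeRing; HeytingField)
open import Algebra.Bundles using (CommutativeRing; Semiring)
import Algebra.Definitions.RawSemiring
import Algebra.Properties.CommutativeSemiring.Exp
import Algebra.Properties.Ring
import Algebra.Properties.Semiring.Exp
import Algebra.Properties.Semiring.Mult
import Algebra.Solver.Ring.NaturalCoefficients.Default
open import Data.Bool using (Bool; true; false; if_then_else_)
open import Data.Fin as Fin using (Fin; zero; suc; toℕ)
import Data.Fin.Properties as Fin
open import Data.List as List
  using (List; []; _∷_; [_]; allFin; cartesianProductWith; filter; length; map)
open import Data.List using (replicate; _++_)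
import Data.List.Properties as List
open import Data.List.Membership.Propositional using (_∈_; find)
open import Data.List.Membership.Propositional.Properties
  using (∈-map⁺; ∈-map⁻; ∈-++⁺ˡ; ∈-++⁺ʳ; ∈-++⁻; ∈-∃++; ∈-concatMap⁺; ∈-concatMap⁻; ∈-deduplicate⁺; ∈-deduplicate⁻)
open import Data.List.Membership.Propositional.Properties.WithK using (unique∧set⇒bag)
open import Data.List.Relation.Binary.BagAndSetEquality using (∼bag⇒↭)
open import Data.List.Relation.Binary.Permutation.Propositional as ↭
  using (_↭_; ↭-refl; ↭-sym; ↭-trans; ↭-prep; ↭-swap)
open import Data.List.Relation.Binary.Permutation.Propositional.Properties
  using (↭-empty-inv; ¬x∷xs↭[]; ∈-resp-↭; drop-mid; drop-∷) renaming (shift to ↭-shift)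
open import Data.List.Relation.Unary.All using ([])
open import Data.List.Relation.Unary.AllPairs using ([]; _∷_)
open import Data.List.Relation.Unary.Any as Any using (here; there)
open import Data.List.Relation.Unary.Unique.Propositional using (Unique)
import Data.List.Relation.Unary.Unique.DecPropositional.Properties as DecUnique
import Data.List.Relation.Unary.Unique.Propositional.Properties as Unique
open import Data.Nat as ℕ using (ℕ; zero; suc; _∸_; _≤_; NonZero; z≤n; s≤s; z<s)
open import Data.Nat.Combinatorics using (_C_; nC1≡n; nCk+nC[k+1]≡[n+1]C[k+1]; nCn≡1; k>n⇒nCk≡0)
import Data.Nat.Properties as ℕ
open import Data.Nat.Properties using (m*n≢0)
import Data.Nat.Solver
open import Data.Product using (_,_; proj₁; proj₂)
open import Data.Sum using (_⊎_; inj₁; inj₂; [_,_]′)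
open import Data.Vec as Vec using (Vec; _∷_)
open import Data.Vec.Functional as Vector using (Vector; head; tail)
open import Data.Vec.Relation.Unary.Linked using (linked?)
open import Function using (_∘_; case_of_; mk⇔)
open import Relation.Binary.PropositionalEquality as ≡ using (_≡_; cong; cong₂)
import Relation.Binary.Reasoning.Setoid
open import Relation.Nullary using (does; yes; no; contradiction)
open import Relation.Unary using (Pred; Decidable)

-- The quantities a and b never occur in the code, since they would live in an extension of the
-- ring. E(a) E(b) is replaced by its coefficient of t^j u^k, the sum over p + i = k of e_p
-- e_(j+k+i) (-1)^i `lucas j i`. Passing from e_p to C(n, p+1) sends an index pair (p, q) to (p+1,
-- q+1): the difference q - p, and with it the Lucas coefficient, is unchanged, while k grows by
-- one. Only the pair with first index 0 is not reached. The Lucas coefficient of that boundary term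
-- is a binomial times (j+2k+2)/(k+1), and j+2k+2 is also the lower index of the C(n, j+2k+2) next
-- to it. Absorption therefore turns the boundary term into a single product with the same factor
-- C(m, r) as the trinomial coefficient. A Heyting field offers no decidable equality, so
-- distinctness of the x_i is phrased as cancellation of a multiplier. The identities hold in any
-- commutative ring satisfying the stated hypotheses, and division by integers is postponed to the
-- end.

-- Binomial, Lucas and trinomial coefficients

pascal : ∀ n k → suc n C suc k ≡ n C k ℕ.+ n C suc k
pascal n k = ≡.sym (nCk+nC[k+1]≡[n+1]C[k+1] n k)

absorption : ∀ n k → suc k ℕ.* (suc n C suc k) ≡ suc n ℕ.* (n C k)
absorption zero zero = ≡.refl
absorption zero (suc k) = ℕ.*-zeroʳ (suc (suc k))
absorption (suc n) zero = begin
  1 ℕ.* (suc (suc n) C 1)                  ≡⟨ cong (1 ℕ.*_) (pascal (suc n) 0) ⟩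
  1 ℕ.* (1 ℕ.+ (suc n C 1))                ≡⟨ ℕ.*-distribˡ-+ 1 1 (suc n C 1) ⟩
  1 ℕ.+ 1 ℕ.* (suc n C 1)                  ≡⟨ cong suc (absorption n 0) ⟩
  suc (suc n ℕ.* (n C 0))                  ≡⟨⟩
  suc (suc n) ℕ.* (suc n C 0)              ∎
  where open ≡.≡-Reasoning
absorption (suc n) (suc k) = begin
  suc (suc k) ℕ.* (suc (suc n) C suc (suc k))
    ≡⟨ cong (suc (suc k) ℕ.*_) (pascal (suc n) (suc k)) ⟩
  suc (suc k) ℕ.* ((suc n C suc k) ℕ.+ (suc n C suc (suc k)))
    ≡⟨ solve 3 (λ k a b → (con 2 :+ k) :* (a :+ b) := a :+ ((con 1 :+ k) :* a) :+ ((con 2 :+ k) :* b))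
         ≡.refl k (suc n C suc k) (suc n C suc (suc k)) ⟩
  (suc n C suc k) ℕ.+ suc k ℕ.* (suc n C suc k) ℕ.+ suc (suc k) ℕ.* (suc n C suc (suc k))
    ≡⟨ cong₂ ℕ._+_ (cong₂ ℕ._+_ (pascal n k) (absorption n k)) (absorption n (suc k)) ⟩
  (n C k) ℕ.+ (n C suc k) ℕ.+ suc n ℕ.* (n C k) ℕ.+ suc n ℕ.* (n C suc k)
    ≡⟨ solve 3 (λ n a b → a :+ b :+ (con 1 :+ n) :* a :+ (con 1 :+ n) :* b := (con 2 :+ n) :* (a :+ b))
         ≡.refl n (n C k) (n C suc k) ⟩
  suc (suc n) ℕ.* ((n C k) ℕ.+ (n C suc k))
    ≡⟨ cong (suc (suc n) ℕ.*_) (pascal n k) ⟨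
  suc (suc n) ℕ.* (suc n C suc k) ∎
  where
  open ≡.≡-Reasoning
  open Data.Nat.Solver.+-*-Solver

-- (-1)^i * lucas j i is the coefficient of (a + b)^j (ab)^i in a^p + b^p, where
-- p = j + 2i (halved for p = 0).
lucas : ℕ → ℕ → ℕ
lucas j zero    = 1
lucas j (suc i) = suc (j ℕ.+ i) C suc i ℕ.+ (j ℕ.+ i) C i

-- With P_p = a^p + b^p, t = a + b and u = ab, this is P_p = t P_(p-1) - u P_(p-2) read off at one
-- monomial, the signs having cancelled.
lucas-suc : ∀ j i → lucas (suc j) (suc i) ≡ lucas j (suc i) ℕ.+ lucas (suc j) i
lucas-suc j zero = begin
  (suc (suc (j ℕ.+ 0)) C 1) ℕ.+ 1              ≡⟨ cong (ℕ._+ 1) (pascal (suc (j ℕ.+ 0)) 0) ⟩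
  1 ℕ.+ (suc (j ℕ.+ 0) C 1) ℕ.+ 1              ≡⟨ cong (ℕ._+ 1) (ℕ.+-comm 1 (suc (j ℕ.+ 0) C 1)) ⟩
  (suc (j ℕ.+ 0) C 1) ℕ.+ 1 ℕ.+ 1              ∎
  where open ≡.≡-Reasoning
lucas-suc j (suc i) rewrite ℕ.+-suc j i = begin
  (suc (suc (suc (j ℕ.+ i))) C suc (suc i)) ℕ.+ (suc (suc (j ℕ.+ i)) C suc i)
    ≡⟨ cong₂ ℕ._+_ (pascal (suc (suc (j ℕ.+ i))) (suc i)) (pascal (suc (j ℕ.+ i)) i) ⟩
  x ℕ.+ y ℕ.+ (z ℕ.+ w)
    ≡⟨ solve 4 (λ x y z w → x :+ y :+ (z :+ w) := y :+ w :+ (x :+ z)) ≡.refl x y z w ⟩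
  y ℕ.+ w ℕ.+ (x ℕ.+ z) ∎
  where
  open ≡.≡-Reasoning
  open Data.Nat.Solver.+-*-Solver
  x = suc (suc (j ℕ.+ i)) C suc i
  y = suc (suc (j ℕ.+ i)) C suc (suc i)
  z = suc (j ℕ.+ i) C i
  w = suc (j ℕ.+ i) C suc i

lucas-zero : ∀ i → lucas 0 (suc i) ≡ 2
lucas-zero i = cong₂ ℕ._+_ (nCn≡1 (suc i)) (nCn≡1 i)

-- The classical coefficient p/(p-i) C(p-i, i), taken at i + 1 and cleared of denominators; the
-- factor before the last binomial is the exponent p = j + 2(i + 1).
lucas-absorption : ∀ j i → suc i ℕ.* lucas j (suc i) ≡ suc (suc (j ℕ.+ i ℕ.+ i)) ℕ.* ((j ℕ.+ i) C i)
lucas-absorption j i = begin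
  suc i ℕ.* ((suc (j ℕ.+ i) C suc i) ℕ.+ x)          ≡⟨ ℕ.*-distribˡ-+ (suc i) (suc (j ℕ.+ i) C suc i) x ⟩
  suc i ℕ.* (suc (j ℕ.+ i) C suc i) ℕ.+ suc i ℕ.* x  ≡⟨ cong (ℕ._+ suc i ℕ.* x) (absorption (j ℕ.+ i) i) ⟩
  suc (j ℕ.+ i) ℕ.* x ℕ.+ suc i ℕ.* x                ≡⟨ solve 3 (λ j i x → (con 1 :+ (j :+ i)) :* x :+ (con 1 :+ i) :* x
                                                          := (con 2 :+ (j :+ i :+ i)) :* x) ≡.refl j i x ⟩
  suc (suc (j ℕ.+ i ℕ.+ i)) ℕ.* x                    ∎
  where
  open ≡.≡-Reasoning
  open Data.Nat.Solver.+-*-Solver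
  x = (j ℕ.+ i) C i

-- The coefficient of t^j u^k in (1 + t + u)^n: choose the factors contributing t or u, then those
-- among them contributing u.
trinomial : ℕ → ℕ → ℕ → ℕ
trinomial n j k = (n C (j ℕ.+ k)) ℕ.* ((j ℕ.+ k) C k)

trinomial-zero : ∀ n j → trinomial n j 0 ≡ n C j
trinomial-zero n j rewrite ℕ.+-identityʳ j = ℕ.*-identityʳ (n C j)

trinomial-suc-suc : ∀ n j k → trinomial (suc n) (suc j) (suc k) ≡
  trinomial n (suc j) (suc k) ℕ.+ (trinomial n j (suc k) ℕ.+ trinomial n (suc j) k)
trinomial-suc-suc n j k rewrite ℕ.+-suc j k
  | pascal n (suc (j ℕ.+ k)) | pascal (suc (j ℕ.+ k)) k =
  solve 4 (λ a b c d → (a :+ b) :* (c :+ d) := b :* (c :+ d) :+ (a :* d :+ a :* c)) ≡.refl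
    (n C suc (j ℕ.+ k)) (n C suc (suc (j ℕ.+ k))) (suc (j ℕ.+ k) C k) (suc (j ℕ.+ k) C suc k)
  where open Data.Nat.Solver.+-*-Solver

-- The inner binomial absorbs k + 1, and the outer one absorbs the factor released by this.
trinomial-absorption : ∀ n j k → suc k ℕ.* trinomial (suc n) j (suc k)
  ≡ suc n ℕ.* (((j ℕ.+ k) C k) ℕ.* (n C (j ℕ.+ k)))
trinomial-absorption n j k rewrite ℕ.+-suc j k = begin
  suc k ℕ.* ((suc n C suc m) ℕ.* (suc m C suc k))
    ≡⟨ solve 3 (λ k a b → k :* (a :* b) := a :* (k :* b)) ≡.refl (suc k) (suc n C suc m) (suc m C suc k) ⟩
  (suc n C suc m) ℕ.* (suc k ℕ.* (suc m C suc k))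
    ≡⟨ cong ((suc n C suc m) ℕ.*_) (absorption m k) ⟩
  (suc n C suc m) ℕ.* (suc m ℕ.* (m C k))
    ≡⟨ solve 3 (λ a b d → a :* (b :* d) := d :* (b :* a)) ≡.refl (suc n C suc m) (suc m) (m C k) ⟩
  (m C k) ℕ.* (suc m ℕ.* (suc n C suc m))
    ≡⟨ cong ((m C k) ℕ.*_) (absorption n m) ⟩
  (m C k) ℕ.* (suc n ℕ.* (n C m))
    ≡⟨ solve 3 (λ a b d → a :* (b :* d) := b :* (a :* d)) ≡.refl (m C k) (suc n) (n C m) ⟩
  suc n ℕ.* ((m C k) ℕ.* (n C m)) ∎
  where
  m = j ℕ.+ k
  open ≡.≡-Reasoning
  open Data.Nat.Solver.+-*-Solver

-- The exponent j + 2k + 2 released by `lucas-absorption` is the lower index of the other binomial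
-- and is absorbed in turn. The factors `suc n` and `(j + k) C k` are those of
-- `trinomial-absorption`, so the two terms can be combined.
lucas-binomial-absorption : ∀ n j k →
  suc k ℕ.* ((suc n C (j ℕ.+ suc k ℕ.+ suc k)) ℕ.* lucas j (suc k))
    ≡ suc n ℕ.* (((j ℕ.+ k) C k) ℕ.* (n C (j ℕ.+ k ℕ.+ k ℕ.+ 1)))
lucas-binomial-absorption n j k rewrite ℕ.+-suc j k | ℕ.+-suc (j ℕ.+ k) k | ℕ.+-comm (j ℕ.+ k ℕ.+ k) 1 = begin
  suc k ℕ.* ((suc n C suc m) ℕ.* lucas j (suc k))
    ≡⟨ solve 3 (λ k a b → k :* (a :* b) := a :* (k :* b)) ≡.refl (suc k) (suc n C suc m) (lucas j (suc k)) ⟩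
  (suc n C suc m) ℕ.* (suc k ℕ.* lucas j (suc k))
    ≡⟨ cong ((suc n C suc m) ℕ.*_) (lucas-absorption j k) ⟩
  (suc n C suc m) ℕ.* (suc m ℕ.* x)
    ≡⟨ solve 3 (λ a b d → a :* (b :* d) := d :* (b :* a)) ≡.refl (suc n C suc m) (suc m) x ⟩
  x ℕ.* (suc m ℕ.* (suc n C suc m))
    ≡⟨ cong (x ℕ.*_) (absorption n m) ⟩
  x ℕ.* (suc n ℕ.* (n C m))
    ≡⟨ solve 3 (λ a b d → a :* (b :* d) := b :* (a :* d)) ≡.refl x (suc n) (n C m) ⟩
  suc n ℕ.* (x ℕ.* (n C m)) ∎
  where
  m = suc (j ℕ.+ k ℕ.+ k)
  x = (j ℕ.+ k) C k
  open ≡.≡-Reasoning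
  open Data.Nat.Solver.+-*-Solver

-- Rearrangements of a list of twos and ones

module _ {a} {A : Set a} where

  ∈-insertions⁻ : ∀ {x : A} ys {zs} → zs ∈ insertions x ys → zs ↭ x ∷ ys
  ∈-insertions⁻ []       (here ≡.refl) = ↭-refl
  ∈-insertions⁻ (y ∷ ys) (here ≡.refl) = ↭-refl
  ∈-insertions⁻ (y ∷ ys) (there zs∈) with _ , ws∈ , ≡.refl ← ∈-map⁻ (y ∷_) zs∈ =
    ↭-trans (↭-prep y (∈-insertions⁻ ys ws∈)) (↭-swap y _ ↭-refl)

  ∈-insertions⁺ : ∀ (x : A) ys zs → ys ++ x ∷ zs ∈ insertions x (ys ++ zs)
  ∈-insertions⁺ x []       []       = here ≡.refl
  ∈-insertions⁺ x []       (z ∷ zs) = here ≡.refl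
  ∈-insertions⁺ x (y ∷ ys) zs       = there (∈-map⁺ (y ∷_) (∈-insertions⁺ x ys zs))

  ∈-permutations⁻ : ∀ (xs : List A) {ys} → ys ∈ permutations xs → ys ↭ xs
  ∈-permutations⁻ []       (here ≡.refl) = ↭-refl
  ∈-permutations⁻ (x ∷ xs) ys∈ with zs , zs∈ , ys∈′ ← find (∈-concatMap⁻ (insertions x) ys∈) =
    ↭-trans (∈-insertions⁻ zs ys∈′) (↭-prep x (∈-permutations⁻ xs zs∈))

  ∈-permutations⁺ : ∀ (xs : List A) {ys} → ys ↭ xs → ys ∈ permutations xs
  ∈-permutations⁺ []       ys↭xs with ≡.refl ← ↭-empty-inv ys↭xs = here ≡.refl
  ∈-permutations⁺ (x ∷ xs) ys↭xs with us , vs , ≡.refl ← ∈-∃++ (∈-resp-↭ (↭-sym ys↭xs) (here ≡.refl)) =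
    ∈-concatMap⁺ (insertions x)
      (Any.map (λ { ≡.refl → ∈-insertions⁺ x us vs }) (∈-permutations⁺ xs (drop-mid us [] ys↭xs)))

-- An enumeration by first letter, free of duplicates by construction; a sum over it follows the
-- recursion of `quadratic`.
words : ℕ → ℕ → List (List ℕ)
words zero    zero    = [ [] ]
words zero    (suc j) = map (1 ∷_) (words zero j)
words (suc r) zero    = map (2 ∷_) (words r zero)
words (suc r) (suc j) = map (2 ∷_) (words r (suc j)) ++ map (1 ∷_) (words (suc r) j)

twosOnes : ℕ → ℕ → List ℕ
twosOnes r j = replicate r 2 ++ replicate j 1

twosOnes-suc : ∀ r j → twosOnes r (suc j) ↭ 1 ∷ twosOnes r j
twosOnes-suc r j = ↭-shift 1 (replicate r 2) (replicate j 1)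

∈-words⁻ : ∀ r j {w} → w ∈ words r j → w ↭ twosOnes r j
∈-words⁻-2 : ∀ r j {w} → w ∈ map (2 ∷_) (words r j) → w ↭ twosOnes (suc r) j
∈-words⁻-1 : ∀ r j {w} → w ∈ map (1 ∷_) (words r j) → w ↭ twosOnes r (suc j)

∈-words⁻ zero    zero    (here ≡.refl) = ↭-refl
∈-words⁻ zero    (suc j) w∈ = ∈-words⁻-1 zero j w∈
∈-words⁻ (suc r) zero    w∈ = ∈-words⁻-2 r zero w∈
∈-words⁻ (suc r) (suc j) w∈ =
  [ ∈-words⁻-2 r (suc j) , ∈-words⁻-1 (suc r) j ]′ (∈-++⁻ (map (2 ∷_) (words r (suc j))) w∈)

∈-words⁻-2 r j w∈ with _ , v∈ , ≡.refl ← ∈-map⁻ (2 ∷_) w∈ = ↭-prep 2 (∈-words⁻ r j v∈)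

∈-words⁻-1 r j w∈ with _ , v∈ , ≡.refl ← ∈-map⁻ (1 ∷_) w∈ =
  ↭-trans (↭-prep 1 (∈-words⁻ r j v∈)) (↭-sym (twosOnes-suc r j))

∈-words-2 : ∀ r j {w} → w ∈ words r j → 2 ∷ w ∈ words (suc r) j
∈-words-2 r zero    w∈ = ∈-map⁺ (2 ∷_) w∈
∈-words-2 r (suc j) w∈ = ∈-++⁺ˡ (∈-map⁺ (2 ∷_) w∈)

∈-words-1 : ∀ r j {w} → w ∈ words r j → 1 ∷ w ∈ words r (suc j)
∈-words-1 zero    j w∈ = ∈-map⁺ (1 ∷_) w∈
∈-words-1 (suc r) j w∈ = ∈-++⁺ʳ (map (2 ∷_) (words r (suc j))) (∈-map⁺ (1 ∷_) w∈)

∈-replicate⁻ : ∀ {a} {A : Set a} n {x y : A} → y ∈ replicate n x → y ≡ x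
∈-replicate⁻ (suc n) (here eq)   = eq
∈-replicate⁻ (suc n) (there y∈) = ∈-replicate⁻ n y∈

∈-twosOnes⁻ : ∀ r j {x} → x ∈ twosOnes r j → x ≡ 2 ⊎ x ≡ 1
∈-twosOnes⁻ r j x∈ with ∈-++⁻ (replicate r 2) x∈
... | inj₁ x∈ = inj₁ (∈-replicate⁻ r x∈)
... | inj₂ x∈ = inj₂ (∈-replicate⁻ j x∈)

2∉ones : ∀ j → 2 ∈ replicate j 1 → ∀ {b} {B : Set b} → B
2∉ones j 2∈ with () ← ∈-replicate⁻ j 2∈

1∉twos : ∀ r → 1 ∈ twosOnes r 0 → ∀ {b} {B : Set b} → B
1∉twos r 1∈ with ∈-++⁻ (replicate r 2) 1∈
... | inj₁ 1∈ with () ← ∈-replicate⁻ r 1∈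

∈-words⁺ : ∀ r j w → w ↭ twosOnes r j → w ∈ words r j
∈-words⁺ zero    zero    []      p = here ≡.refl
∈-words⁺ zero    (suc j) []      p = contradiction (↭-sym p) ¬x∷xs↭[]
∈-words⁺ (suc r) j       []      p = contradiction (↭-sym p) ¬x∷xs↭[]
∈-words⁺ r       j       (x ∷ w) p with ∈-twosOnes⁻ r j (∈-resp-↭ p (here ≡.refl))
∈-words⁺ zero    j       (_ ∷ w) p | inj₁ ≡.refl = 2∉ones j (∈-resp-↭ p (here ≡.refl))
∈-words⁺ (suc r) j       (_ ∷ w) p | inj₁ ≡.refl = ∈-words-2 r j (∈-words⁺ r j w (drop-∷ p))
∈-words⁺ r       zero    (_ ∷ w) p | inj₂ ≡.refl = 1∉twos r (∈-resp-↭ p (here ≡.refl))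
∈-words⁺ r       (suc j) (_ ∷ w) p | inj₂ ≡.refl =
  ∈-words-1 r j (∈-words⁺ r j w (drop-∷ (↭-trans p (twosOnes-suc r j))))

words-unique : ∀ r j → Unique (words r j)
words-unique zero    zero    = [] ∷ []
words-unique zero    (suc j) = Unique.map⁺ List.∷-injectiveʳ (words-unique zero j)
words-unique (suc r) zero    = Unique.map⁺ List.∷-injectiveʳ (words-unique r zero)
words-unique (suc r) (suc j) = Unique.++⁺
  (Unique.map⁺ List.∷-injectiveʳ (words-unique r (suc j)))
  (Unique.map⁺ List.∷-injectiveʳ (words-unique (suc r) j))
  λ (p , q) → case ∈-map⁻ (2 ∷_) p , ∈-map⁻ (1 ∷_) q of λ { ((_ , _ , ≡.refl) , (_ , _ , ())) }

-- Two duplicate-free lists with the same members agree up to order, which a sum does not see;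
-- `deduplicate` is never computed.
distinctRearrangements↭words : ∀ r j → distinctRearrangements (twosOnes r j) ↭ words r j
distinctRearrangements↭words r j = ∼bag⇒↭ (unique∧set⇒bag
  (DecUnique.deduplicate-! (List.≡-dec ℕ._≟_) (permutations (twosOnes r j)))
  (words-unique r j)
  (mk⇔ (λ w∈ → ∈-words⁺ r j _ (∈-permutations⁻ (twosOnes r j) (∈-deduplicate⁻ (List.≡-dec ℕ._≟_) _ w∈)))
       (λ w∈ → ∈-deduplicate⁺ (List.≡-dec ℕ._≟_) (∈-permutations⁺ (twosOnes r j) (∈-words⁻ r j w∈)))))

module SymmetricFunctions {c ℓ} (R : CommutativeRing c ℓ) where

  open CommutativeRing R hiding (zero)
  open Algebra.Properties.Ring ring using (-1*x≈-x)
  open Algebra.Properties.Semiring.Mult semiring using (_×_; ×-homo-+; ×1-homo-*)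
  open Algebra.Properties.Semiring.Exp semiring using (_^_)
  open Algebra.Solver.Ring.NaturalCoefficients.Default commutativeSemiring
  open Relation.Binary.Reasoning.Setoid setoid

  -- Convolution of coefficient sequences

  shift : (ℕ → Carrier) → ℕ → Carrier
  shift f zero    = 0#
  shift f (suc i) = f i

  cauchy : (ℕ → Carrier) → (ℕ → Carrier) → ℕ → Carrier
  cauchy f g zero    = f 0 * g 0
  cauchy f g (suc k) = f 0 * g (suc k) + cauchy (f ∘ suc) g k

  cauchy-cong : ∀ {f f′ g g′} → (∀ i → f i ≈ f′ i) → (∀ i → g i ≈ g′ i) →
                ∀ k → cauchy f g k ≈ cauchy f′ g′ k
  cauchy-cong p q zero    = *-cong (p 0) (q 0)
  cauchy-cong p q (suc k) = +-cong (*-cong (p 0) (q (suc k))) (cauchy-cong (p ∘ suc) q k)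

  cauchy-linearˡ : ∀ x f f′ g k →
    cauchy (λ i → f i + x * f′ i) g k ≈ cauchy f g k + x * cauchy f′ g k
  cauchy-linearˡ x f f′ g zero =
    solve 4 (λ x a a′ b → (a :+ x :* a′) :* b := a :* b :+ x :* (a′ :* b)) refl x (f 0) (f′ 0) (g 0)
  cauchy-linearˡ x f f′ g (suc k) = begin
    (f 0 + x * f′ 0) * g (suc k) + cauchy (λ i → f (suc i) + x * f′ (suc i)) g k
      ≈⟨ +-congˡ (cauchy-linearˡ x (f ∘ suc) (f′ ∘ suc) g k) ⟩
    (f 0 + x * f′ 0) * g (suc k) + (cauchy (f ∘ suc) g k + x * cauchy (f′ ∘ suc) g k)
      ≈⟨ solve 6 (λ x a a′ b s s′ → (a :+ x :* a′) :* b :+ (s :+ x :* s′)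
            := a :* b :+ s :+ x :* (a′ :* b :+ s′)) refl x (f 0) (f′ 0) (g (suc k)) _ _ ⟩
    cauchy f g (suc k) + x * cauchy f′ g (suc k) ∎

  cauchy-linearʳ : ∀ x f g g′ k →
    cauchy f (λ i → g i + x * g′ i) k ≈ cauchy f g k + x * cauchy f g′ k
  cauchy-linearʳ x f g g′ zero =
    solve 4 (λ x a b b′ → a :* (b :+ x :* b′) := a :* b :+ x :* (a :* b′)) refl x (f 0) (g 0) (g′ 0)
  cauchy-linearʳ x f g g′ (suc k) = begin
    f 0 * (g (suc k) + x * g′ (suc k)) + cauchy (f ∘ suc) (λ i → g i + x * g′ i) k
      ≈⟨ +-congˡ (cauchy-linearʳ x (f ∘ suc) g g′ k) ⟩
    f 0 * (g (suc k) + x * g′ (suc k)) + (cauchy (f ∘ suc) g k + x * cauchy (f ∘ suc) g′ k)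
      ≈⟨ solve 6 (λ x a b b′ s s′ → a :* (b :+ x :* b′) :+ (s :+ x :* s′)
            := a :* b :+ s :+ x :* (a :* b′ :+ s′)) refl x (f 0) (g (suc k)) (g′ (suc k)) _ _ ⟩
    cauchy f g (suc k) + x * cauchy f g′ (suc k) ∎

  cauchy-scale : ∀ x f g k → cauchy (λ i → x * f i) (λ i → x * g i) k ≈ x * x * cauchy f g k
  cauchy-scale x f g zero =
    solve 3 (λ x a b → x :* a :* (x :* b) := x :* x :* (a :* b)) refl x (f 0) (g 0)
  cauchy-scale x f g (suc k) = begin
    x * f 0 * (x * g (suc k)) + cauchy (λ i → x * f (suc i)) (λ i → x * g i) k
      ≈⟨ +-congˡ (cauchy-scale x (f ∘ suc) g k) ⟩
    x * f 0 * (x * g (suc k)) + x * x * cauchy (f ∘ suc) g k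
      ≈⟨ solve 4 (λ x a b s → x :* a :* (x :* b) :+ x :* x :* s := x :* x :* (a :* b :+ s))
           refl x (f 0) (g (suc k)) _ ⟩
    x * x * cauchy f g (suc k) ∎

  -- The recursion of `cauchy` peels off `f 0`; peeling off `g 0` is what shifts and vanishing tails
  -- of the right argument call for.
  cauchy-suc : ∀ f g k → cauchy f g (suc k) ≈ f (suc k) * g 0 + cauchy f (g ∘ suc) k
  cauchy-suc f g zero    = +-comm _ _
  cauchy-suc f g (suc k) = begin
    f 0 * g (suc (suc k)) + cauchy (f ∘ suc) g (suc k)
      ≈⟨ +-congˡ (cauchy-suc (f ∘ suc) g k) ⟩
    f 0 * g (suc (suc k)) + (f (suc (suc k)) * g 0 + cauchy (f ∘ suc) (g ∘ suc) k)
      ≈⟨ solve 3 (λ a b s → a :+ (b :+ s) := b :+ (a :+ s)) refl _ _ _ ⟩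
    f (suc (suc k)) * g 0 + cauchy f (g ∘ suc) (suc k) ∎

  cauchy-shiftˡ : ∀ f g k → cauchy (shift f) g (suc k) ≈ cauchy f g k
  cauchy-shiftˡ f g k = trans (+-congʳ (zeroˡ _)) (+-identityˡ _)

  cauchy-shiftʳ : ∀ f g k → cauchy f (shift g) (suc k) ≈ cauchy f g k
  cauchy-shiftʳ f g k = trans (cauchy-suc f (shift g) k) (trans (+-congʳ (zeroʳ _)) (+-identityˡ _))

  cauchy-zeroʳ : ∀ f g → (∀ i → g i ≈ 0#) → ∀ k → cauchy f g k ≈ 0#
  cauchy-zeroʳ f g p zero    = trans (*-congˡ (p 0)) (zeroʳ _)
  cauchy-zeroʳ f g p (suc k) =
    trans (+-cong (trans (*-congˡ (p (suc k))) (zeroʳ _)) (cauchy-zeroʳ (f ∘ suc) g p k)) (+-identityʳ 0#)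

  cauchy-constʳ : ∀ f g → (∀ i → g (suc i) ≈ 0#) → ∀ k → cauchy f g k ≈ f k * g 0
  cauchy-constʳ f g p zero    = refl
  cauchy-constʳ f g p (suc k) =
    trans (cauchy-suc f g k) (trans (+-congˡ (cauchy-zeroʳ f (g ∘ suc) p k)) (+-identityʳ _))

  -- The product of quadratic factors as a Lucas convolution

  one : ℕ → Carrier
  one zero    = 1#
  one (suc _) = 0#

  elementary : ∀ {n} → Vector Carrier n → ℕ → Carrier
  elementary {zero}  x = one
  elementary {suc n} x = λ i → elementary (tail x) i + head x * shift (elementary (tail x)) i

  -- The coefficient of t^j u^k in ∏ (1 + t xᵢ + u xᵢ²).
  quadratic : ∀ {n} → Vector Carrier n → ℕ → ℕ → Carrier
  quadratic {zero}  x j zero    = one j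
  quadratic {zero}  x j (suc k) = 0#
  quadratic {suc n} x j k =
    q j k + (head x * shift (λ i → q i k) j + head x ^ 2 * shift (q j) k)
    where q = quadratic (tail x)

  signedLucas : ℕ → ℕ → Carrier
  signedLucas j i = (- 1#) ^ i * (lucas j i × 1#)

  -- The recurrence P_p + u P_(p-2) = t P_(p-1) for P_p = a^p + b^p, at the monomial t^(j+1)
  -- u^(i+1).
  signedLucas-suc : ∀ j i → signedLucas (suc j) (suc i) + signedLucas (suc j) i ≈ signedLucas j (suc i)
  signedLucas-suc j i = begin
    - 1# * s * (lucas (suc j) (suc i) × 1#) + s * d
      ≡⟨ cong (λ l → - 1# * s * (l × 1#) + s * d) (lucas-suc j i) ⟩
    - 1# * s * ((lucas j (suc i) ℕ.+ lucas (suc j) i) × 1#) + s * d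
      ≈⟨ +-congʳ (*-congˡ (×-homo-+ 1# (lucas j (suc i)) _)) ⟩
    - 1# * s * (a + d) + s * d
      ≈⟨ solve 4 (λ m s a d → m :* s :* (a :+ d) :+ s :* d := m :* s :* a :+ (con 1 :+ m) :* (s :* d))
           refl (- 1#) s a d ⟩
    - 1# * s * a + (1# - 1#) * (s * d)
      ≈⟨ +-congˡ (trans (*-congʳ (-‿inverseʳ 1#)) (zeroˡ _)) ⟩
    - 1# * s * a + 0#
      ≈⟨ +-identityʳ _ ⟩
    - 1# * s * a ∎
    where
    s = (- 1#) ^ i
    a = lucas j (suc i) × 1#
    d = lucas (suc j) i × 1#

  -- The same recurrence at t^0, where a multiple of t has coefficient zero.
  signedLucas-zero-suc : ∀ i → signedLucas 0 (suc (suc i)) + signedLucas 0 (suc i) ≈ 0#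
  signedLucas-zero-suc i rewrite lucas-zero i | lucas-zero (suc i) = begin
    - 1# * s * d + s * d ≈⟨ +-congʳ (trans (*-assoc _ s d) (-1*x≈-x (s * d))) ⟩
    - (s * d) + s * d    ≈⟨ -‿inverseˡ _ ⟩
    0#                   ∎
    where
    s = (- 1#) ^ suc i
    d = 2 × 1#

  -- Here the recurrence misses zero because P_0 = 2 enters halved: -2 + 1 instead of -2 + 2.
  signedLucas-zero-one : signedLucas 0 1 + signedLucas 0 0 ≈ - 1#
  signedLucas-zero-one = begin
    - 1# * 1# * (1# + (1# + 0#)) + 1# * (1# + 0#)
      ≈⟨ solve 1 (λ m → m :* con 1 :* (con 1 :+ (con 1 :+ con 0)) :+ con 1 :* (con 1 :+ con 0) := m :+ (m :+ con 1)) refl (- 1#) ⟩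
    - 1# + (- 1# + 1#)
      ≈⟨ +-congˡ (-‿inverseˡ 1#) ⟩
    - 1# + 0#
      ≈⟨ +-identityʳ _ ⟩
    - 1# ∎

  -- For m = j + k, the cofactor of e_p in the coefficient of t^j u^k, where p + i = k and the
  -- partner index is p + j + 2i = m + i. The argument `m` is kept apart from j because a new
  -- variable changes it alone.
  lucasTerm : (ℕ → Carrier) → ℕ → ℕ → ℕ → Carrier
  lucasTerm e j m i = e (m ℕ.+ i) * signedLucas j i

  lucasTerm-index : ∀ e j {m m′} → m ≡ m′ → ∀ i → lucasTerm e j m i ≈ lucasTerm e j m′ i
  lucasTerm-index e j ≡.refl i = refl

  -- The shift lowers i while `suc m` raises the index, so both terms carry the same value of `e`
  -- and only the Lucas recurrence remains. The factor `1#` fits the shape of `cauchy-linearʳ`.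
  lucasTerm-suc : ∀ e j m i →
    lucasTerm e (suc j) m i + 1# * shift (lucasTerm e (suc j) (suc m)) i ≈ lucasTerm e j m i
  lucasTerm-suc e j m zero = trans (+-congˡ (zeroʳ _)) (+-identityʳ _)
  lucasTerm-suc e j m (suc i) = begin
    e (m ℕ.+ suc i) * a + 1# * (e (suc (m ℕ.+ i)) * b)
      ≡⟨ cong (λ l → e (m ℕ.+ suc i) * a + 1# * (e l * b)) (≡.sym (ℕ.+-suc m i)) ⟩
    e (m ℕ.+ suc i) * a + 1# * (e (m ℕ.+ suc i) * b)
      ≈⟨ trans (+-congˡ (*-identityˡ _)) (sym (distribˡ _ a b)) ⟩
    e (m ℕ.+ suc i) * (a + b)
      ≈⟨ *-congˡ (signedLucas-suc j i) ⟩
    e (m ℕ.+ suc i) * signedLucas j (suc i) ∎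
    where
    a = signedLucas (suc j) (suc i)
    b = signedLucas (suc j) i

  -- What a new variable would draw from t^(-1) when j = 0, hence zero. The recurrence kills all but
  -- two summands, e_(k+1) e_k and - e_k e_(k+1), the latter due to the halved P_0.
  cauchy-lucasTerm-zero : ∀ e k →
    cauchy e (λ i → lucasTerm e 0 k i + 1# * shift (lucasTerm e 0 (suc k)) i) (suc k) ≈ 0#
  cauchy-lucasTerm-zero e k = begin
    cauchy e h (suc k)
      ≈⟨ cauchy-suc e h k ⟩
    e (suc k) * h 0 + cauchy e (h ∘ suc) k
      ≈⟨ +-cong (*-congˡ h₀) (cauchy-constʳ e (h ∘ suc) h₂ k) ⟩
    e (suc k) * e k + e k * h 1
      ≈⟨ +-congˡ (*-congˡ h₁) ⟩
    e (suc k) * e k + e k * (e (suc k) * - 1#)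
      ≈⟨ solve 3 (λ a b m → a :* b :+ b :* (a :* m) := a :* b :* (con 1 :+ m)) refl (e (suc k)) (e k) (- 1#) ⟩
    e (suc k) * e k * (1# - 1#)
      ≈⟨ *-congˡ (-‿inverseʳ 1#) ⟩
    e (suc k) * e k * 0#
      ≈⟨ zeroʳ _ ⟩
    0# ∎
    where
    h : ℕ → Carrier
    h i = lucasTerm e 0 k i + 1# * shift (lucasTerm e 0 (suc k)) i

    h₀ : h 0 ≈ e k
    h₀ rewrite ℕ.+-identityʳ k =
      solve 1 (λ x → x :* (con 1 :* (con 1 :+ con 0)) :+ con 1 :* con 0 := x) refl (e k)

    h-suc : ∀ i → h (suc i) ≈ e (k ℕ.+ suc i) * (signedLucas 0 (suc i) + signedLucas 0 i)
    h-suc i rewrite ℕ.+-suc k i = trans (+-congˡ (*-identityˡ _)) (sym (distribˡ _ _ _))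

    h₁ : h 1 ≈ e (suc k) * - 1#
    h₁ = trans (h-suc 0) (trans (*-congˡ signedLucas-zero-one)
           (*-congʳ (reflexive (cong e (ℕ.+-comm k 1)))))

    h₂ : ∀ i → h (suc (suc i)) ≈ 0#
    h₂ i = trans (h-suc (suc i)) (trans (*-congˡ (signedLucas-zero-suc i)) (zeroʳ _))

  -- A new variable multiplies E(a) by 1 + a x and E(b) by 1 + b x. Taking x from the first sequence
  -- lowers k, taking it from the second lowers `m`; the two cross terms together form the
  -- coefficient of x.
  cauchy-lucasTerm-extend : ∀ x e j m k → let e′ = λ i → e i + x * shift e i in
    cauchy e′ (lucasTerm e′ j (suc m)) (suc k)
      ≈ cauchy e (lucasTerm e j (suc m)) (suc k)
        + (x * cauchy e (λ i → lucasTerm e j m i + 1# * shift (lucasTerm e j (suc m)) i) (suc k)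
          + x ^ 2 * cauchy e (lucasTerm e j m) k)
  cauchy-lucasTerm-extend x e j m k = begin
    cauchy e′ (lucasTerm e′ j (suc m)) (suc k)
      ≈⟨ cauchy-cong {f = e′} (λ i → refl) split (suc k) ⟩
    cauchy e′ (λ i → g₁ i + x * g₂ i) (suc k)
      ≈⟨ cauchy-linearʳ x e′ g₁ g₂ (suc k) ⟩
    cauchy e′ g₁ (suc k) + x * cauchy e′ g₂ (suc k)
      ≈⟨ +-cong (extend g₁) (*-congˡ (extend g₂)) ⟩
    cauchy e g₁ (suc k) + x * cauchy e g₁ k + x * (cauchy e g₂ (suc k) + x * cauchy e g₂ k)
      ≈⟨ solve 5 (λ x a b c d → a :+ x :* b :+ x :* (c :+ x :* d)
             := a :+ (x :* (c :+ con 1 :* b) :+ x :^ 2 :* d)) refl x _ _ _ _ ⟩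
    cauchy e g₁ (suc k) + (x * (cauchy e g₂ (suc k) + 1# * cauchy e g₁ k) + x ^ 2 * cauchy e g₂ k)
      ≈⟨ +-congˡ (+-congʳ (*-congˡ (+-congˡ (*-congˡ (sym (cauchy-shiftʳ e g₁ k)))))) ⟩
    cauchy e g₁ (suc k) + (x * (cauchy e g₂ (suc k) + 1# * cauchy e (shift g₁) (suc k)) + x ^ 2 * cauchy e g₂ k)
      ≈⟨ +-congˡ (+-congʳ (*-congˡ (sym (cauchy-linearʳ 1# e g₂ (shift g₁) (suc k))))) ⟩
    cauchy e g₁ (suc k)
      + (x * cauchy e (λ i → g₂ i + 1# * shift g₁ i) (suc k) + x ^ 2 * cauchy e g₂ k) ∎
    where
    e′ g₁ g₂ : ℕ → Carrier
    e′ i = e i + x * shift e i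
    g₁ = lucasTerm e j (suc m)
    g₂ = lucasTerm e j m

    split : ∀ i → lucasTerm e′ j (suc m) i ≈ g₁ i + x * g₂ i
    split i = solve 4 (λ x a b l → (a :+ x :* b) :* l := a :* l :+ x :* (b :* l)) refl x _ _ _

    extend : ∀ g → cauchy e′ g (suc k) ≈ cauchy e g (suc k) + x * cauchy e g k
    extend g = trans (cauchy-linearˡ x e (shift e) g (suc k)) (+-congˡ (*-congˡ (cauchy-shiftˡ e g k)))

  -- With t = a + b and u = ab, 1 + t x + u x² = (1 + a x)(1 + b x), so the product over all x is
  -- ∑ e_p e_q a^p b^q; each a^p b^q + a^q b^p is (ab)^p times a Lucas polynomial in t and u.
  quadratic≈cauchy : ∀ {n} (x : Vector Carrier n) j k →
    quadratic x j k ≈ cauchy (elementary x) (lucasTerm (elementary x) j (j ℕ.+ k)) k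
  quadratic≈cauchy {zero} x zero zero =
    solve 0 (con 1 := con 1 :* (con 1 :* (con 1 :* (con 1 :+ con 0)))) refl
  quadratic≈cauchy {zero} x (suc j) zero = sym (trans (*-congˡ (zeroˡ _)) (zeroʳ _))
  quadratic≈cauchy {zero} x j (suc k) = sym (cauchy-zeroʳ one _ vanish (suc k))
    where
    vanish : ∀ i → lucasTerm one j (j ℕ.+ suc k) i ≈ 0#
    vanish i rewrite ℕ.+-suc j k = zeroˡ _
  quadratic≈cauchy {suc n} x j zero with elementary (tail x) | quadratic≈cauchy (tail x)
  ... | e | ih = helper j
    where
    q = quadratic (tail x)
    e′ : ℕ → Carrier
    e′ i = e i + head x * shift e i
    helper : ∀ j → q j 0 + (head x * shift (λ i → q i 0) j + head x ^ 2 * 0#)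
                   ≈ e′ 0 * lucasTerm e′ j (j ℕ.+ 0) 0
    helper zero = trans (+-congʳ (ih 0 0))
      (solve 3 (λ x a l → a :* (a :* l) :+ (x :* con 0 :+ x :^ 2 :* con 0)
                  := (a :+ x :* con 0) :* ((a :+ x :* con 0) :* l)) refl (head x) _ _)
    helper (suc j) = trans (+-cong (ih (suc j) 0) (+-congʳ (*-congˡ (ih j 0))))
      (solve 5 (λ x a b c l → a :* (b :* l) :+ (x :* (a :* (c :* l)) :+ x :^ 2 :* con 0)
                  := (a :+ x :* con 0) :* ((b :+ x :* c) :* l)) refl (head x) _ _ _ _)
  quadratic≈cauchy {suc n} x zero (suc k) with elementary (tail x) | quadratic≈cauchy (tail x)
  ... | e | ih = begin
    q 0 (suc k) + (head x * 0# + head x ^ 2 * q 0 k)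
      -- At t^0 the new factor has no linear contribution; its zero is traded for the vanishing
      -- cross terms, so that the extension formula applies.
      ≈⟨ +-cong (ih 0 (suc k)) (+-cong (*-congˡ (sym (cauchy-lucasTerm-zero e k))) (*-congˡ (ih 0 k))) ⟩
    _
      ≈⟨ cauchy-lucasTerm-extend (head x) e 0 k k ⟨
    _ ∎
    where q = quadratic (tail x)
  quadratic≈cauchy {suc n} x (suc j) (suc k) with elementary (tail x) | quadratic≈cauchy (tail x)
  ... | e | ih = begin
    q (suc j) (suc k) + (head x * q j (suc k) + head x ^ 2 * q (suc j) k)
      -- The sum for j is rewritten as the two cross terms for j + 1 that the extension formula
      -- expects.
      ≈⟨ +-cong (ih (suc j) (suc k)) (+-cong
           (*-congˡ (trans (ih j (suc k)) (cauchy-cong {f = e} (λ _ → refl) (λ i → sym (lucasTerm-suc e j (j ℕ.+ suc k) i)) (suc k))))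
           (*-congˡ (trans (ih (suc j) k) (cauchy-cong {f = e} (λ _ → refl) (lucasTerm-index e (suc j) (≡.sym (ℕ.+-suc j k))) k)))) ⟩
    _
      ≈⟨ cauchy-lucasTerm-extend (head x) e (suc j) (j ℕ.+ suc k) k ⟨
    _ ∎
    where q = quadratic (tail x)

  -- All variables equal to one

  elementary-ones : ∀ n k → elementary (Vector.replicate n 1#) k ≈ (n C k) × 1#
  elementary-ones zero zero = sym (+-identityʳ 1#)
  elementary-ones zero (suc k) = refl
  elementary-ones (suc n) zero = trans (+-congˡ (zeroʳ 1#)) (trans (+-identityʳ _) (elementary-ones n zero))
  elementary-ones (suc n) (suc k) = begin
    elementary (Vector.replicate n 1#) (suc k) + 1# * elementary (Vector.replicate n 1#) k
      ≈⟨ +-cong (elementary-ones n (suc k)) (trans (*-identityˡ _) (elementary-ones n k)) ⟩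
    (n C suc k) × 1# + (n C k) × 1#
      ≈⟨ +-comm _ _ ⟩
    (n C k) × 1# + (n C suc k) × 1#
      ≈⟨ ×-homo-+ 1# (n C k) (n C suc k) ⟨
    ((n C k) ℕ.+ (n C suc k)) × 1#
      ≡⟨ cong (_× 1#) (pascal n k) ⟨
    (suc n C suc k) × 1# ∎

  elementary-vanish : ∀ {n} (x : Vector Carrier n) {k} → n ℕ.< k → elementary x k ≈ 0#
  elementary-vanish {zero}  x {suc k} _ = refl
  elementary-vanish {suc n} x {suc k} (s≤s n<k) =
    trans (+-cong (elementary-vanish (tail x) (ℕ.m≤n⇒m≤1+n n<k))
                  (trans (*-congˡ (elementary-vanish (tail x) n<k)) (zeroʳ _)))
          (+-identityʳ 0#)

  quadratic-ones : ∀ n j k → quadratic (Vector.replicate n 1#) j k ≈ trinomial n j k × 1#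
  quadratic-ones zero zero zero = sym (+-identityʳ 1#)
  quadratic-ones zero (suc j) zero = refl
  quadratic-ones zero j (suc k) rewrite ℕ.+-suc j k = refl
  quadratic-ones (suc n) zero zero = begin
    quadratic (Vector.replicate n 1#) 0 0 + (1# * 0# + 1# ^ 2 * 0#)
      ≈⟨ trans (+-congˡ (trans (+-cong (zeroʳ _) (zeroʳ _)) (+-identityʳ 0#))) (+-identityʳ _) ⟩
    quadratic (Vector.replicate n 1#) 0 0
      ≈⟨ quadratic-ones n 0 0 ⟩
    1 × 1# ∎
  quadratic-ones (suc n) (suc j) zero = begin
    q (suc j) 0 + (1# * q j 0 + 1# ^ 2 * 0#)
      ≈⟨ +-congˡ (trans (+-cong (*-identityˡ _) (zeroʳ _)) (+-identityʳ _)) ⟩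
    q (suc j) 0 + q j 0
      ≈⟨ +-comm _ _ ⟩
    q j 0 + q (suc j) 0
      ≈⟨ +-cong (quadratic-ones n j 0) (quadratic-ones n (suc j) 0) ⟩
    trinomial n j 0 × 1# + trinomial n (suc j) 0 × 1#
      ≈⟨ ×-homo-+ 1# (trinomial n j 0) (trinomial n (suc j) 0) ⟨
    (trinomial n j 0 ℕ.+ trinomial n (suc j) 0) × 1#
      ≡⟨ cong (_× 1#) (≡.trans (cong₂ ℕ._+_ (trinomial-zero n j) (trinomial-zero n (suc j)))
           (≡.trans (≡.sym (pascal n j)) (≡.sym (trinomial-zero (suc n) (suc j))))) ⟩
    trinomial (suc n) (suc j) 0 × 1# ∎
    where q = quadratic (Vector.replicate n 1#)
  quadratic-ones (suc n) zero (suc k) = begin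
    q 0 (suc k) + (1# * 0# + 1# ^ 2 * q 0 k)
      ≈⟨ solve 2 (λ a b → a :+ (con 1 :* con 0 :+ con 1 :^ 2 :* b) := b :+ a) refl _ _ ⟩
    q 0 k + q 0 (suc k)
      ≈⟨ +-cong (quadratic-ones n 0 k) (quadratic-ones n 0 (suc k)) ⟩
    trinomial n 0 k × 1# + trinomial n 0 (suc k) × 1#
      ≈⟨ ×-homo-+ 1# (trinomial n 0 k) (trinomial n 0 (suc k)) ⟨
    (trinomial n 0 k ℕ.+ trinomial n 0 (suc k)) × 1#
      ≡⟨ cong (_× 1#) (≡.trans (cong₂ ℕ._+_ (diag n k) (diag n (suc k)))
           (≡.trans (≡.sym (pascal n k)) (≡.sym (diag (suc n) (suc k))))) ⟩
    trinomial (suc n) 0 (suc k) × 1# ∎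
    where
    q = quadratic (Vector.replicate n 1#)
    diag : ∀ n k → trinomial n 0 k ≡ n C k
    diag n k = ≡.trans (cong ((n C k) ℕ.*_) (nCn≡1 k)) (ℕ.*-identityʳ (n C k))
  quadratic-ones (suc n) (suc j) (suc k) = begin
    q (suc j) (suc k) + (1# * q j (suc k) + 1# ^ 2 * q (suc j) k)
      ≈⟨ solve 3 (λ a b c → a :+ (con 1 :* b :+ con 1 :^ 2 :* c) := a :+ (b :+ c)) refl _ _ _ ⟩
    q (suc j) (suc k) + (q j (suc k) + q (suc j) k)
      ≈⟨ +-cong (quadratic-ones n (suc j) (suc k))
           (+-cong (quadratic-ones n j (suc k)) (quadratic-ones n (suc j) k)) ⟩
    a × 1# + (b × 1# + d × 1#)
      ≈⟨ +-congˡ (×-homo-+ 1# b d) ⟨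
    a × 1# + (b ℕ.+ d) × 1#
      ≈⟨ ×-homo-+ 1# a (b ℕ.+ d) ⟨
    (a ℕ.+ (b ℕ.+ d)) × 1#
      ≡⟨ cong (_× 1#) (trinomial-suc-suc n j k) ⟨
    trinomial (suc n) (suc j) (suc k) × 1# ∎
    where
    q = quadratic (Vector.replicate n 1#)
    a = trinomial n (suc j) (suc k)
    b = trinomial n j (suc k)
    d = trinomial n (suc j) k

  -- Polynomials and Vieta's formulas

  -- With the leading coefficient first, the partial values `horner a i w` are the coefficients that
  -- synthetic division at `w` produces.
  horner : (ℕ → Carrier) → ℕ → Carrier → Carrier
  horner a zero    w = a 0
  horner a (suc n) w = horner a n w * w + a (suc n)

  horner-cong : ∀ {a b} → (∀ i → a i ≈ b i) → ∀ n {v w} → v ≈ w → horner a n v ≈ horner b n w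
  horner-cong p zero    v≈w = p 0
  horner-cong p (suc n) v≈w = +-cong (*-cong (horner-cong p n v≈w) v≈w) (p (suc n))

  -- The coefficients on the left are those of a product with w + x. The sequence `b` is not cut off
  -- after n, so `b (suc n)` stays as the remainder.
  horner-factor : ∀ x b n w →
    horner (λ i → b i + x * shift b i) (suc n) w ≈ horner b n w * (w + x) + b (suc n)
  horner-factor x b zero w =
    solve 4 (λ x a b w → (a :+ x :* con 0) :* w :+ (b :+ x :* a) := a :* (w :+ x) :+ b)
      refl x (b 0) (b 1) w
  horner-factor x b (suc n) w = trans (+-congʳ (*-congʳ (horner-factor x b n w)))
    (solve 5 (λ x w h a b → (h :* (w :+ x) :+ a) :* w :+ (b :+ x :* a) := (h :* w :+ a) :* (w :+ x) :+ b)
      refl x w (horner b n w) (b (suc n)) (b (suc (suc n))))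

  horner-suc : ∀ a n w → horner a (suc n) w ≈ a 0 * w ^ suc n + horner (a ∘ suc) n w
  horner-suc a zero w = +-congʳ (*-congˡ (sym (*-identityʳ w)))
  horner-suc a (suc n) w = trans (+-congʳ (*-congʳ (horner-suc a n w)))
    (solve 5 (λ a w p h b → (a :* p :+ h) :* w :+ b := a :* (w :* p) :+ (h :* w :+ b))
      refl (a 0) w (w ^ suc n) (horner (a ∘ suc) n w) (a (suc (suc n))))

  horner-elementary-ones : ∀ n w → horner (elementary (Vector.replicate n 1#)) n w ≈ (w + 1#) ^ n
  horner-elementary-ones zero w = refl
  horner-elementary-ones (suc n) w = begin
    horner (elementary (Vector.replicate (suc n) 1#)) (suc n) w
      ≈⟨ horner-factor 1# e n w ⟩
    horner e n w * (w + 1#) + e (suc n)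
      ≈⟨ +-cong (*-congʳ (horner-elementary-ones n w)) (elementary-vanish (Vector.replicate n 1#) ℕ.≤-refl) ⟩
    (w + 1#) ^ n * (w + 1#) + 0#
      ≈⟨ trans (+-identityʳ _) (*-comm _ _) ⟩
    (w + 1#) ^ suc n ∎
    where e = elementary (Vector.replicate n 1#)

  horner-binomial : ∀ n w → w ^ suc n + horner (λ k → (suc n C suc k) × 1#) n w ≈ (w + 1#) ^ suc n
  horner-binomial n w = begin
    w ^ suc n + horner (λ k → (suc n C suc k) × 1#) n w
      ≈⟨ +-congʳ (trans (*-congʳ (+-identityʳ 1#)) (*-identityˡ _)) ⟨
    (suc n C 0) × 1# * w ^ suc n + horner (λ k → (suc n C suc k) × 1#) n w
      ≈⟨ horner-suc (λ k → (suc n C k) × 1#) n w ⟨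
    horner (λ k → (suc n C k) × 1#) (suc n) w
      ≈⟨ horner-cong (elementary-ones (suc n)) (suc n) refl ⟨
    horner (elementary (Vector.replicate (suc n) 1#)) (suc n) w
      ≈⟨ horner-elementary-ones (suc n) w ⟩
    (w + 1#) ^ suc n ∎

  cancel-+ : ∀ {x y} → x + y ≈ x → y ≈ 0#
  cancel-+ {x} {y} p = begin
    y             ≈⟨ +-identityˡ y ⟨
    0# + y        ≈⟨ +-congʳ (-‿inverseˡ x) ⟨
    - x + x + y   ≈⟨ +-assoc _ _ _ ⟩
    - x + (x + y) ≈⟨ +-congˡ p ⟩
    - x + x       ≈⟨ -‿inverseˡ x ⟩
    0#            ∎

  -- Synthetic division by w + x_0, then induction on the quotient. Distinctness is stated as: a
  -- difference of two x_i is no zero divisor. This suffices to cancel a linear factor where nothing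
  -- can be inverted.
  vieta : ∀ {n} (x : Vector Carrier n) →
    (∀ {i j} → i Fin.< j → ∀ z → z * x i ≈ z * x j → z ≈ 0#) →
    ∀ a → (∀ i → horner a n (- x i) ≈ 0#) →
    ∀ {k} → k ≤ n → a k ≈ a 0 * elementary x k
  vieta {zero} x separated a roots z≤n = sym (*-identityʳ _)
  vieta {suc n} x separated a roots {k} k≤n = begin
    a k
      ≈⟨ expand k ⟩
    b k + x₀ * shift b k
      ≈⟨ +-cong (quotient k≤n) (*-congˡ (shifted k k≤n)) ⟩
    a 0 * e k + x₀ * (a 0 * shift e k)
      ≈⟨ solve 4 (λ a e x s → a :* e :+ x :* (a :* s) := a :* (e :+ x :* s)) refl (a 0) (e k) x₀ (shift e k) ⟩
    a 0 * elementary x k ∎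
    where
    x₀ = head x
    e  = elementary (tail x)

    b : ℕ → Carrier
    b i = horner a i (- x₀)

    expand : ∀ i → a i ≈ b i + x₀ * shift b i
    expand zero = sym (trans (+-congˡ (zeroʳ x₀)) (+-identityʳ _))
    expand (suc i) = sym (begin
      b i * - x₀ + a (suc i) + x₀ * b i
        ≈⟨ solve 4 (λ b m a x → b :* m :+ a :+ x :* b := b :* (m :+ x) :+ a) refl (b i) (- x₀) (a (suc i)) x₀ ⟩
      b i * (- x₀ + x₀) + a (suc i)
        ≈⟨ +-congʳ (trans (*-congˡ (-‿inverseˡ x₀)) (zeroʳ _)) ⟩
      0# + a (suc i)
        ≈⟨ +-identityˡ _ ⟩
      a (suc i) ∎)

    -- The value of the quotient times - y + x_0 vanishes, so x_0 and y agree after multiplication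
    -- by `h`, and separation gives h = 0.
    roots′ : ∀ i → horner b n (- tail x i) ≈ 0#
    roots′ i = separated {zero} {suc i} (s≤s z≤n) h (begin
      h * x₀
        ≈⟨ *-congˡ (trans (+-congʳ (-‿inverseʳ y)) (+-identityˡ x₀)) ⟨
      h * (y - y + x₀)
        ≈⟨ solve 4 (λ h y m x → h :* (y :+ m :+ x) := h :* y :+ h :* (m :+ x)) refl h y (- y) x₀ ⟩
      h * y + h * (- y + x₀)
        ≈⟨ +-congˡ factor≈0 ⟩
      h * y + 0#
        ≈⟨ +-identityʳ _ ⟩
      h * y ∎)
      where
      y = tail x i
      h = horner b n (- y)

      factor≈0 : h * (- y + x₀) ≈ 0#
      factor≈0 = begin
        h * (- y + x₀)
          ≈⟨ +-identityʳ _ ⟨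
        h * (- y + x₀) + 0#
          ≈⟨ +-congˡ (roots zero) ⟨
        h * (- y + x₀) + b (suc n)
          ≈⟨ horner-factor x₀ b n (- y) ⟨
        horner (λ i → b i + x₀ * shift b i) (suc n) (- y)
          ≈⟨ horner-cong expand (suc n) refl ⟨
        horner a (suc n) (- y)
          ≈⟨ roots (suc i) ⟩
        0# ∎

    quotient : ∀ {k} → k ≤ suc n → b k ≈ a 0 * e k
    quotient {k} k≤1+n with ℕ.m≤n⇒m<n∨m≡n k≤1+n
    ... | inj₁ (s≤s k≤n) = vieta (tail x) (λ i<j → separated (s≤s i<j)) b roots′ k≤n
    -- `b (suc n)` is the remainder of the division, zero because - x_0 is a root.
    ... | inj₂ ≡.refl    =
      trans (roots zero) (sym (trans (*-congˡ (elementary-vanish (tail x) ℕ.≤-refl)) (zeroʳ _)))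

    shifted : ∀ k → k ≤ suc n → shift b k ≈ a 0 * shift e k
    shifted zero    _   = sym (zeroʳ _)
    shifted (suc k) k<n = quotient (ℕ.<⇒≤ k<n)

  -- The closed form in a commutative ring

  -- Every summand contains two elementary functions, so the square of `suc n` turns both into
  -- binomials. The term in front is the summand p = 0 that completes the convolution at k + 1.
  quadratic-binomial : ∀ {n} (x : Vector Carrier n) →
    (∀ k → (suc n × 1#) * elementary x k ≈ (suc n C suc k) × 1#) →
    ∀ j k → (suc n C (j ℕ.+ suc k ℕ.+ suc k)) × 1# * signedLucas j (suc k)
      + (suc n × 1#) * (suc n × 1#) * quadratic x j k ≈ trinomial (suc n) j (suc k) × 1#
  quadratic-binomial {n} x e≈binomial j k = begin
    (suc n C (j ℕ.+ suc k ℕ.+ suc k)) × 1# * signedLucas j (suc k) + ν * ν * quadratic x j k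
      -- The factor `b 0`, equal to one, is inserted to make this the first summand of `cauchy b` at
      -- `suc k`.
      ≈⟨ +-cong (sym (trans (*-congʳ (+-identityʳ 1#)) (*-identityˡ _))) (begin
        ν * ν * quadratic x j k
          ≈⟨ *-congˡ (quadratic≈cauchy x j k) ⟩
        ν * ν * cauchy e (lucasTerm e j (j ℕ.+ k)) k
          ≈⟨ cauchy-scale ν e (lucasTerm e j (j ℕ.+ k)) k ⟨
        cauchy (λ i → ν * e i) (λ i → ν * lucasTerm e j (j ℕ.+ k) i) k
          ≈⟨ cauchy-cong e≈binomial (λ i → trans (sym (*-assoc _ _ _)) (*-congʳ (trans (e≈binomial (j ℕ.+ k ℕ.+ i))
               (reflexive (cong (λ l → (suc n C (l ℕ.+ i)) × 1#) (≡.sym (ℕ.+-suc j k))))))) k ⟩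
        cauchy (b ∘ suc) (lucasTerm b j (j ℕ.+ suc k)) k ∎) ⟩
    cauchy b (lucasTerm b j (j ℕ.+ suc k)) (suc k)
      ≈⟨ cauchy-cong (elementary-ones (suc n)) (λ i → *-congʳ (elementary-ones (suc n) (j ℕ.+ suc k ℕ.+ i))) (suc k) ⟨
    cauchy (elementary (Vector.replicate (suc n) 1#)) (lucasTerm (elementary (Vector.replicate (suc n) 1#)) j (j ℕ.+ suc k)) (suc k)
      ≈⟨ quadratic≈cauchy (Vector.replicate (suc n) 1#) j (suc k) ⟨
    quadratic (Vector.replicate (suc n) 1#) j (suc k)
      ≈⟨ quadratic-ones (suc n) j (suc k) ⟩
    trinomial (suc n) j (suc k) × 1# ∎
    where
    ν = suc n × 1#
    e = elementary x
    b : ℕ → Carrier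
    b i = (suc n C i) × 1#


  -- Multiplication by `suc k` brings both absorption identities into play. The common factor
  -- `suc n` stays on both sides because a ring need not allow its cancellation.
  quadratic-closedForm : ∀ {n} (x : Vector Carrier n) →
    (∀ k → (suc n × 1#) * elementary x k ≈ (suc n C suc k) × 1#) →
    ∀ j k → (suc n × 1#) * ((suc k × 1#) * (suc n × 1#) * quadratic x j k)
      ≈ (suc n × 1#) * (((j ℕ.+ k) C k) × 1#
          * ((n C (j ℕ.+ k)) × 1# + (- 1#) ^ k * ((n C (j ℕ.+ k ℕ.+ k ℕ.+ 1)) × 1#)))
  quadratic-closedForm {n} x e≈binomial j k = begin
    ν * (κ * ν * q)
      ≈⟨ +-identityʳ _ ⟨
    ν * (κ * ν * q) + 0#
      -- A zero written with 1 - 1 carries the boundary term to the other side; to the solver `- 1#`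
      -- is an opaque variable.
      ≈⟨ +-congˡ (trans (*-congʳ (-‿inverseʳ 1#)) (zeroˡ _)) ⟨
    ν * (κ * ν * q) + (1# - 1#) * (s * (κ * (B * l)))
      ≈⟨ solve 7 (λ ν κ q m s B l → ν :* (κ :* ν :* q) :+ (con 1 :+ m) :* (s :* (κ :* (B :* l)))
           := κ :* (B :* (m :* s :* l) :+ ν :* ν :* q) :+ s :* (κ :* (B :* l)))
           refl ν κ q (- 1#) s B l ⟩
    κ * (B * signedLucas j (suc k) + ν * ν * q) + s * (κ * (B * l))
      ≈⟨ +-cong (*-congˡ (quadratic-binomial x e≈binomial j k))
           (*-congˡ (*-congˡ (sym (×1-homo-* (suc n C (j ℕ.+ suc k ℕ.+ suc k)) (lucas j (suc k)))))) ⟩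
    κ * (trinomial (suc n) j (suc k) × 1#) + s * (κ * (((suc n C (j ℕ.+ suc k ℕ.+ suc k)) ℕ.* lucas j (suc k)) × 1#))
      ≈⟨ +-cong (absorb (suc k) (trinomial (suc n) j (suc k)) (suc n) ((j ℕ.+ k) C k) (n C (j ℕ.+ k))
             (trinomial-absorption n j k))
           (*-congˡ (absorb (suc k) ((suc n C (j ℕ.+ suc k ℕ.+ suc k)) ℕ.* lucas j (suc k)) (suc n)
             ((j ℕ.+ k) C k) (n C (j ℕ.+ k ℕ.+ k ℕ.+ 1)) (lucas-binomial-absorption n j k))) ⟩
    ν * (b * c₁) + s * (ν * (b * c₂))
      ≈⟨ solve 5 (λ ν b c₁ c₂ s → ν :* (b :* c₁) :+ s :* (ν :* (b :* c₂)) := ν :* (b :* (c₁ :+ s :* c₂)))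
           refl ν b c₁ c₂ s ⟩
    ν * (b * (c₁ + s * c₂)) ∎
    where
    ν = suc n × 1#
    κ = suc k × 1#
    q = quadratic x j k
    s = (- 1#) ^ k
    B = (suc n C (j ℕ.+ suc k ℕ.+ suc k)) × 1#
    l = lucas j (suc k) × 1#
    b = ((j ℕ.+ k) C k) × 1#
    c₁ = (n C (j ℕ.+ k)) × 1#
    c₂ = (n C (j ℕ.+ k ℕ.+ k ℕ.+ 1)) × 1#

    absorb : ∀ a b c d e → a ℕ.* b ≡ c ℕ.* (d ℕ.* e) →
             (a × 1#) * (b × 1#) ≈ (c × 1#) * ((d × 1#) * (e × 1#))
    absorb a b c d e eq = trans (sym (×1-homo-* a b)) (trans (reflexive (cong (_× 1#) eq))
      (trans (×1-homo-* c (d ℕ.* e)) (*-congˡ (×1-homo-* d e))))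

module HeytingFieldSums {c ℓ₁ ℓ₂} (K : HeytingField c ℓ₁ ℓ₂) where

  open HeytingField K using (heytingCommutativeRing; _#_; #⇒invertible)
  open HeytingCommutativeRing heytingCommutativeRing using (commutativeRing)
  open CommutativeRing commutativeRing hiding (zero)
  open SymmetricFunctions commutativeRing
  open Algebra.Properties.Ring ring using (-0#≈0#; -‿distribʳ-*; +-cancelˡ)
  open Algebra.Properties.Semiring.Mult semiring using (_×_)
  open Algebra.Properties.Semiring.Exp semiring using (_^_; ^-homo-*; ^-assocʳ; ^-congˡ)
  open Algebra.Properties.CommutativeSemiring.Exp commutativeSemiring using (^-distrib-*)
  open Algebra.Definitions.RawSemiring (Semiring.rawSemiring semiring) using (product)
  open Algebra.Solver.Ring.NaturalCoefficients.Default commutativeSemiring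
  open Relation.Binary.Reasoning.Setoid setoid

  -- Finite sums over lists

  module _ {a} {A : Set a} where

    sumOver-cong : ∀ (xs : List A) {f g : A → Carrier} → (∀ x → f x ≈ g x) → sumOver K xs f ≈ sumOver K xs g
    sumOver-cong []       p = refl
    sumOver-cong (x ∷ xs) p = +-cong (p x) (sumOver-cong xs p)

    sumOver-zero : ∀ (xs : List A) → sumOver K xs (λ _ → 0#) ≈ 0#
    sumOver-zero []       = refl
    sumOver-zero (x ∷ xs) = trans (+-identityˡ _) (sumOver-zero xs)

    sumOver-++ : ∀ (xs ys : List A) f → sumOver K (xs ++ ys) f ≈ sumOver K xs f + sumOver K ys f
    sumOver-++ []       ys f = sym (+-identityˡ _)
    sumOver-++ (x ∷ xs) ys f = trans (+-congˡ (sumOver-++ xs ys f)) (sym (+-assoc _ _ _))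

    sumOver-linear : ∀ (xs : List A) y f g →
      sumOver K xs (λ x → y * f x + g x) ≈ y * sumOver K xs f + sumOver K xs g
    sumOver-linear []       y f g = sym (trans (+-identityʳ _) (zeroʳ y))
    sumOver-linear (x ∷ xs) y f g = trans (+-congˡ (sumOver-linear xs y f g))
      (solve 5 (λ y a b s t → y :* a :+ b :+ (y :* s :+ t) := y :* (a :+ s) :+ (b :+ t)) refl y (f x) (g x) _ _)

    sumOver-*ˡ : ∀ (xs : List A) y f → sumOver K xs (λ x → y * f x) ≈ y * sumOver K xs f
    sumOver-*ˡ []       y f = sym (zeroʳ y)
    sumOver-*ˡ (x ∷ xs) y f = trans (+-congˡ (sumOver-*ˡ xs y f)) (sym (distribˡ _ _ _))

    sumOver-↭ : ∀ {xs ys : List A} f → xs ↭ ys → sumOver K xs f ≈ sumOver K ys f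
    sumOver-↭ f ↭.refl         = refl
    sumOver-↭ f (↭.prep x p)   = +-congˡ (sumOver-↭ f p)
    sumOver-↭ f (↭.swap x y p) = trans (+-congˡ (+-congˡ (sumOver-↭ f p)))
      (solve 3 (λ a b s → a :+ (b :+ s) := b :+ (a :+ s)) refl (f x) (f y) _)
    sumOver-↭ f (↭.trans p q)  = trans (sumOver-↭ f p) (sumOver-↭ f q)

    sumOver-map : ∀ {b} {B : Set b} (h : B → A) xs f → sumOver K (map h xs) f ≡ sumOver K xs (f ∘ h)
    sumOver-map h xs f = cong (List.foldr _+_ 0#) (≡.sym (List.map-∘ {g = f} {f = h} xs))

    sumOver-filter : ∀ {p} {P : Pred A p} (P? : Decidable P) xs f →
      sumOver K (filter P? xs) f ≈ sumOver K xs (λ x → if does (P? x) then f x else 0#)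
    sumOver-filter P? []       f = refl
    sumOver-filter P? (x ∷ xs) f with does (P? x)
    ... | true  = +-congˡ (sumOver-filter P? xs f)
    ... | false = trans (sumOver-filter P? xs f) (sym (+-identityˡ _))

  sumOver-cartesianProductWith : ∀ {a b d} {A : Set a} {B : Set b} {D : Set d} (_∙_ : A → B → D) xs ys f →
    sumOver K (cartesianProductWith _∙_ xs ys) f ≈ sumOver K xs (λ x → sumOver K ys (λ y → f (x ∙ y)))
  sumOver-cartesianProductWith _∙_ []       ys f = refl
  sumOver-cartesianProductWith _∙_ (x ∷ xs) ys f =
    trans (sumOver-++ (map (x ∙_) ys) _ f)
      (+-cong (reflexive (sumOver-map (x ∙_) ys f)) (sumOver-cartesianProductWith _∙_ xs ys f))

  sumOver-allFin : ∀ n (f : Fin (suc n) → Carrier) {g : Fin n → Carrier} → (∀ j → f (suc j) ≈ g j) →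
    sumOver K (allFin (suc n)) f ≈ f zero + sumOver K (allFin n) g
  sumOver-allFin n f {g} f∘suc≈g = +-congˡ (begin
    sumOver K (List.tabulate suc) f           ≡⟨ cong (λ xs → sumOver K xs f) (List.map-tabulate (λ i → i) suc) ⟨
    sumOver K (map suc (allFin n)) f          ≡⟨ sumOver-map suc (allFin n) f ⟩
    sumOver K (allFin n) (f ∘ suc)            ≈⟨ sumOver-cong (allFin n) f∘suc≈g ⟩
    sumOver K (allFin n) g                    ∎)

  -- Sums over increasing tuples as monomial quasisymmetric functions

  monomial : ∀ {n} → Vector Carrier n → (s : List ℕ) → Vec (Fin n) (length s) → Carrier
  monomial x s i = product λ k → x (Vec.lookup i k) ^ List.lookup s k

  -- The part of the monomial quasisymmetric function whose indices all exceed `i`; nesting the sums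
  -- leaves one inequality to test per summation.
  quasimonomialAfter : ∀ {n} → Vector Carrier n → List ℕ → Fin n → Carrier
  quasimonomialAfter x []      i = 1#
  quasimonomialAfter x (s ∷ t) i =
    sumOver K (allFin _) λ j → if does (i Fin.<? j) then x j ^ s * quasimonomialAfter x t j else 0#

  quasimonomial : ∀ {n} → Vector Carrier n → List ℕ → Carrier
  quasimonomial x []      = 1#
  quasimonomial x (s ∷ t) = sumOver K (allFin _) λ j → x j ^ s * quasimonomialAfter x t j

  sumOver-if : ∀ {a} {A : Set a} (xs : List A) y (b : A → Bool) (f : A → Carrier) →
    sumOver K xs (λ x → if b x then y * f x else 0#) ≈ y * sumOver K xs (λ x → if b x then f x else 0#)
  sumOver-if xs y b f = trans (sumOver-cong xs pull) (sumOver-*ˡ xs y _)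
    where
    pull : ∀ x → (if b x then y * f x else 0#) ≈ y * (if b x then f x else 0#)
    pull x with b x
    ... | true  = refl
    ... | false = sym (zeroʳ y)

  -- The test on `i ∷ j ∷ v` is the conjunction of `i < j` and the test on `j ∷ v`, so the guard
  -- splits along the nested sums.
  sumOver-linkedAfter : ∀ {n} (x : Vector Carrier n) s i →
    sumOver K (tuples n (length s)) (λ v → if does (linked? Fin._<?_ (i ∷ v)) then monomial x s v else 0#)
      ≈ quasimonomialAfter x s i

  sumOver-linked : ∀ {n} (x : Vector Carrier n) s t j →
    sumOver K (tuples n (length t)) (λ v → if does (linked? Fin._<?_ (j ∷ v)) then monomial x (s ∷ t) (j ∷ v) else 0#)
      ≈ x j ^ s * quasimonomialAfter x t j
  sumOver-linked x s t j =
    trans (sumOver-if (tuples _ (length t)) (x j ^ s) (λ v → does (linked? Fin._<?_ (j ∷ v))) (monomial x t))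
      (*-congˡ (sumOver-linkedAfter x t j))

  sumOver-linkedAfter x []      i = +-identityʳ 1#
  sumOver-linkedAfter {n} x (s ∷ t) i =
    trans (sumOver-cartesianProductWith _∷_ (allFin n) (tuples n (length t))
            (λ v → if does (linked? Fin._<?_ (i ∷ v)) then monomial x (s ∷ t) v else 0#))
      (sumOver-cong (allFin n) split)
    where
    split : ∀ j → sumOver K (tuples _ (length t))
        (λ v → if does (linked? Fin._<?_ (i ∷ j ∷ v)) then monomial x (s ∷ t) (j ∷ v) else 0#)
      ≈ (if does (i Fin.<? j) then x j ^ s * quasimonomialAfter x t j else 0#)
    split j with does (i Fin.<? j)
    ... | true  = sumOver-linked x s t j
    ... | false = sumOver-zero (tuples _ (length t))

  sumOver-increasingTuples : ∀ {n} (x : Vector Carrier n) s →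
    sumOver K (increasingTuples n (length s)) (monomial x s) ≈ quasimonomial x s
  sumOver-increasingTuples x []      = +-identityʳ 1#
  sumOver-increasingTuples {n} x (s ∷ t) = begin
    sumOver K (increasingTuples n (suc (length t))) (monomial x (s ∷ t))
      ≈⟨ sumOver-filter (linked? Fin._<?_) (tuples n (suc (length t))) _ ⟩
    sumOver K (tuples n (suc (length t))) (λ v → if does (linked? Fin._<?_ v) then monomial x (s ∷ t) v else 0#)
      ≈⟨ sumOver-cartesianProductWith _∷_ (allFin n) (tuples n (length t)) _ ⟩
    sumOver K (allFin n) (λ j → sumOver K (tuples n (length t))
        (λ v → if does (linked? Fin._<?_ (j ∷ v)) then monomial x (s ∷ t) (j ∷ v) else 0#))
      ≈⟨ sumOver-cong (allFin n) (sumOver-linked x s t) ⟩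
    quasimonomial x (s ∷ t) ∎

  quasimonomialAfter-suc : ∀ {n} (x : Vector Carrier (suc n)) s i →
    quasimonomialAfter x s (suc i) ≈ quasimonomialAfter (tail x) s i
  quasimonomialAfter-suc x []      i = refl
  quasimonomialAfter-suc x (s ∷ t) i =
    trans (sumOver-allFin _ (λ j → if does (suc i Fin.<? j) then x j ^ s * quasimonomialAfter x t j else 0#) step)
      (+-identityˡ _)
    where
    step : ∀ j → (if does (suc i Fin.<? suc j) then x (suc j) ^ s * quasimonomialAfter x t (suc j) else 0#)
               ≈ (if does (i Fin.<? j) then tail x j ^ s * quasimonomialAfter (tail x) t j else 0#)
    -- Both guards compute to this Boolean, since comparison strips the two successors.
    step j with toℕ i ℕ.<ᵇ toℕ j
    ... | true  = *-congˡ (quasimonomialAfter-suc x t j)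
    ... | false = refl

  quasimonomialAfter-zero : ∀ {n} (x : Vector Carrier (suc n)) s →
    quasimonomialAfter x s zero ≈ quasimonomial (tail x) s
  quasimonomialAfter-zero x []      = refl
  quasimonomialAfter-zero {n} x (s ∷ t) = trans
    (sumOver-allFin _ (λ j → if does (Fin.zero {n} Fin.<? j) then x j ^ s * quasimonomialAfter x t j else 0#)
      λ j → *-congˡ (quasimonomialAfter-suc x t j))
    (+-identityˡ _)

  -- Index zero can only come first in an increasing tuple: it carries the exponent `s` or does not
  -- occur.
  quasimonomial-suc : ∀ {n} (x : Vector Carrier (suc n)) s t →
    quasimonomial x (s ∷ t) ≈ head x ^ s * quasimonomial (tail x) t + quasimonomial (tail x) (s ∷ t)
  quasimonomial-suc x s t = trans
    (sumOver-allFin _ (λ j → x j ^ s * quasimonomialAfter x t j) λ j → *-congˡ (quasimonomialAfter-suc x t j))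
    (+-congʳ (*-congˡ (quasimonomialAfter-zero x t)))

  sumOver-cons-suc : ∀ {n} (x : Vector Carrier (suc n)) s W →
    sumOver K (map (s ∷_) W) (quasimonomial x)
      ≈ head x ^ s * sumOver K W (quasimonomial (tail x)) + sumOver K (map (s ∷_) W) (quasimonomial (tail x))
  sumOver-cons-suc x s W = begin
    sumOver K (map (s ∷_) W) (quasimonomial x)
      ≡⟨ sumOver-map (s ∷_) W (quasimonomial x) ⟩
    sumOver K W (λ w → quasimonomial x (s ∷ w))
      ≈⟨ sumOver-cong W (quasimonomial-suc x s) ⟩
    sumOver K W (λ w → head x ^ s * quasimonomial (tail x) w + quasimonomial (tail x) (s ∷ w))
      ≈⟨ sumOver-linear W (head x ^ s) _ _ ⟩
    head x ^ s * sumOver K W (quasimonomial (tail x)) + sumOver K W (λ w → quasimonomial (tail x) (s ∷ w))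
      ≡⟨ cong (head x ^ s * sumOver K W (quasimonomial (tail x)) +_) (sumOver-map (s ∷_) W (quasimonomial (tail x))) ⟨
    head x ^ s * sumOver K W (quasimonomial (tail x)) + sumOver K (map (s ∷_) W) (quasimonomial (tail x)) ∎

  sumOver-cons-zero : ∀ (x : Vector Carrier 0) s W → sumOver K (map (s ∷_) W) (quasimonomial x) ≈ 0#
  sumOver-cons-zero x s W = trans (reflexive (sumOver-map (s ∷_) W (quasimonomial x))) (sumOver-zero W)

  -- Each factor 1 + t x + u x^2 records whether its variable is skipped or has exponent 1 or 2. The
  -- head variable can serve only the first letter of a word, the letter on which `words` recurses.
  sumOver-words : ∀ {n} (x : Vector Carrier n) r j →
    sumOver K (words r j) (quasimonomial x) ≈ quadratic x j r
  sumOver-words {zero} x zero    zero    = +-identityʳ 1#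
  sumOver-words {zero} x zero    (suc j) = sumOver-cons-zero x 1 (words zero j)
  sumOver-words {zero} x (suc r) zero    = sumOver-cons-zero x 2 (words r zero)
  sumOver-words {zero} x (suc r) (suc j) =
    trans (sumOver-++ (map (2 ∷_) (words r (suc j))) _ _)
      (trans (+-cong (sumOver-cons-zero x 2 (words r (suc j))) (sumOver-cons-zero x 1 (words (suc r) j)))
        (+-identityʳ 0#))
  sumOver-words {suc n} x zero zero =
    trans (sumOver-words (tail x) zero zero)
      (solve 3 (λ a b c → a := a :+ (b :* con 0 :+ c :* con 0)) refl _ (head x) (head x ^ 2))
  sumOver-words {suc n} x zero (suc j) =
    trans (sumOver-cons-suc x 1 (words zero j))
      (trans (+-cong (*-congˡ (sumOver-words (tail x) zero j)) (sumOver-words (tail x) zero (suc j)))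
        (solve 4 (λ x y a b → x :^ 1 :* a :+ b := b :+ (x :* a :+ y :* con 0)) refl (head x) (head x ^ 2) _ _))
  sumOver-words {suc n} x (suc r) zero =
    trans (sumOver-cons-suc x 2 (words r zero))
      (trans (+-cong (*-congˡ (sumOver-words (tail x) r zero)) (sumOver-words (tail x) (suc r) zero))
        (solve 4 (λ x y a b → y :* a :+ b := b :+ (x :* con 0 :+ y :* a)) refl (head x) (head x ^ 2) _ _))
  sumOver-words {suc n} x (suc r) (suc j) = begin
    sumOver K (W₂ ++ W₁) (quasimonomial x)
      ≈⟨ sumOver-++ W₂ W₁ _ ⟩
    sumOver K W₂ (quasimonomial x) + sumOver K W₁ (quasimonomial x)
      ≈⟨ +-cong (sumOver-cons-suc x 2 (words r (suc j))) (sumOver-cons-suc x 1 (words (suc r) j)) ⟩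
    head x ^ 2 * sumOver K (words r (suc j)) m + sumOver K W₂ m
      + (head x ^ 1 * sumOver K (words (suc r) j) m + sumOver K W₁ m)
      ≈⟨ solve 6 (λ x y a b c d → y :* a :+ b :+ (x :^ 1 :* c :+ d) := b :+ d :+ (x :* c :+ y :* a))
           refl (head x) (head x ^ 2) _ _ _ _ ⟩
    sumOver K W₂ m + sumOver K W₁ m
      + (head x * sumOver K (words (suc r) j) m + head x ^ 2 * sumOver K (words r (suc j)) m)
      ≈⟨ +-cong (trans (sym (sumOver-++ W₂ W₁ m)) (sumOver-words (tail x) (suc r) (suc j)))
           (+-cong (*-congˡ (sumOver-words (tail x) (suc r) j)) (*-congˡ (sumOver-words (tail x) r (suc j)))) ⟩
    quadratic x (suc j) (suc r) ∎
    where
    W₂ = map (2 ∷_) (words r (suc j))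
    W₁ = map (1 ∷_) (words (suc r) j)
    m  = quasimonomial (tail x)

  -- Elementary symmetric functions of the 1/(1 - ζ^i)

  inverseOfDifference-inverseˡ : ∀ {x y} (x#y : x # y) → inverseOfDifference K x#y * (x - y) ≈ 1#
  inverseOfDifference-inverseˡ x#y = proj₁ (proj₂ (#⇒invertible x#y))

  invertible-cancel : ∀ {u v z} → u * v ≈ 1# → z * v ≈ 0# → z ≈ 0#
  invertible-cancel {u} {v} {z} uv≈1 zv≈0 = begin
    z           ≈⟨ *-identityʳ z ⟨
    z * 1#      ≈⟨ *-congˡ uv≈1 ⟨
    z * (u * v) ≈⟨ solve 3 (λ z u v → z :* (u :* v) := u :* (z :* v)) refl z u v ⟩
    u * (z * v) ≈⟨ *-congˡ zv≈0 ⟩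
    u * 0#      ≈⟨ zeroʳ u ⟩
    0#          ∎

  module RootsOfUnity {n ζ} (prim : IsPrimitiveRoot K (suc n) ζ) where
    open IsPrimitiveRoot prim

    x : Vector Carrier n
    x = inverse1-ζ^ K prim

    1^ : ∀ k → 1# ^ k ≈ 1#
    1^ zero    = refl
    1^ (suc k) = trans (*-identityˡ _) (1^ k)

    x≈1+ζx : ∀ i → x i ≈ 1# + x i * ζ ^ suc (toℕ i)
    x≈1+ζx i = begin
      x i                          ≈⟨ +-identityʳ _ ⟨
      x i + 0#                     ≈⟨ +-congˡ (trans (*-congˡ (-‿inverseˡ z)) (zeroʳ _)) ⟨
      x i + x i * (- z + z)        ≈⟨ solve 3 (λ x m z → x :+ x :* (m :+ z) := x :* (con 1 :+ m) :+ x :* z) refl (x i) (- z) z ⟩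
      x i * (1# - z) + x i * z     ≈⟨ +-congʳ (inverseOfDifference-inverseˡ (1#ζᵏ z<s (ℕ.pred-cancel-< (Fin.toℕ<n i)))) ⟩
      1# + x i * z                 ∎
      where z = ζ ^ suc (toℕ i)

    ζ-powerˡ : ∀ k → (ζ ^ k) ^ suc n ≈ 1#
    ζ-powerˡ k = begin
      (ζ ^ k) ^ suc n   ≈⟨ ^-assocʳ ζ k (suc n) ⟩
      ζ ^ (k ℕ.* suc n) ≡⟨ cong (ζ ^_) (ℕ.*-comm k (suc n)) ⟩
      ζ ^ (suc n ℕ.* k) ≈⟨ ^-assocʳ ζ (suc n) k ⟨
      (ζ ^ suc n) ^ k   ≈⟨ ^-congˡ k ζⁿ≈1 ⟩
      1# ^ k            ≈⟨ 1^ k ⟩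
      1#                ∎

    binomials : ℕ → Carrier
    binomials k = (suc n C suc k) × 1#

    -- (1 + w)^(n+1) - w^(n+1) has leading coefficient n + 1 and vanishes at w = -1/(1 - ζ^i),
    -- because then 1 + w = ζ^i w.
    binomials-root : ∀ i → horner binomials n (- x i) ≈ 0#
    binomials-root i = cancel-+ (begin
      w ^ suc n + horner binomials n w ≈⟨ horner-binomial n w ⟩
      (w + 1#) ^ suc n                 ≈⟨ ^-congˡ (suc n) w+1≈ζw ⟩
      (z * w) ^ suc n                  ≈⟨ ^-distrib-* z w (suc n) ⟩
      z ^ suc n * w ^ suc n            ≈⟨ *-congʳ (ζ-powerˡ (suc (toℕ i))) ⟩
      1# * w ^ suc n                   ≈⟨ *-identityˡ _ ⟩
      w ^ suc n                        ∎)
      where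
      w = - x i
      z = ζ ^ suc (toℕ i)

      w+1≈ζw : w + 1# ≈ z * w
      w+1≈ζw = begin
        w + 1#
          ≈⟨ +-identityʳ _ ⟨
        w + 1# + 0#
          ≈⟨ +-congˡ (trans (*-congˡ (-‿inverseʳ (x i))) (zeroʳ z)) ⟨
        w + 1# + z * (x i + w)
          ≈⟨ solve 3 (λ w z x → w :+ con 1 :+ z :* (x :+ w) := w :+ (con 1 :+ x :* z) :+ z :* w) refl w z (x i) ⟩
        w + (1# + x i * z) + z * w
          ≈⟨ +-congʳ (trans (+-congˡ (sym (x≈1+ζx i))) (-‿inverseˡ (x i))) ⟩
        0# + z * w
          ≈⟨ +-identityˡ _ ⟩
        z * w ∎

    -- Expanding both sides by `x≈1+ζx` gives p = p q with q = ζ^(j-i). As 1 - q is invertible, p =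
    -- 0; cancelling the root of unity in p then yields z x_i = 0, while z = z + p = z x_i.
    x-separated : ∀ {i j} → i Fin.< j → ∀ z → z * x i ≈ z * x j → z ≈ 0#
    x-separated {i} {j} i<j z zxᵢ≈zxⱼ = begin
      z                ≈⟨ +-identityʳ z ⟨
      z + 0#           ≈⟨ +-congˡ p≈0 ⟨
      z + p            ≈⟨ expand i ⟨
      -- The inverse of ζ^k is its n-th power: (ζ^k)^(n+1) = 1 unfolds to a product with ζ^k.
      z * x i          ≈⟨ invertible-cancel (trans (*-comm _ _) (ζ-powerˡ (suc (toℕ i)))) p≈0 ⟩
      0#               ∎
      where
      d = toℕ j ∸ toℕ i
      q = ζ ^ d
      p = z * x i * ζ ^ suc (toℕ i)

      1#q : 1# # q
      1#q = 1#ζᵏ (ℕ.m<n⇒0<n∸m i<j) (ℕ.≤-<-trans (ℕ.m∸n≤m (toℕ j) (toℕ i)) (ℕ.m≤n⇒m≤1+n (Fin.toℕ<n j)))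

      expand : ∀ k → z * x k ≈ z + z * x k * ζ ^ suc (toℕ k)
      expand k = trans (*-congˡ (x≈1+ζx k))
        (solve 3 (λ z x y → z :* (con 1 :+ x :* y) := z :+ z :* x :* y) refl z (x k) _)

      p≈pq : p ≈ p * q
      p≈pq = +-cancelˡ z _ _ (begin
        z + p                              ≈⟨ expand i ⟨
        z * x i                            ≈⟨ zxᵢ≈zxⱼ ⟩
        z * x j                            ≈⟨ expand j ⟩
        z + z * x j * ζ ^ suc (toℕ j)      ≈⟨ +-congˡ (*-cong (sym zxᵢ≈zxⱼ) ζʲ) ⟩
        z + z * x i * (ζ ^ suc (toℕ i) * q) ≈⟨ +-congˡ (*-assoc _ _ q) ⟨
        z + p * q                          ∎)
        where
        ζʲ : ζ ^ suc (toℕ j) ≈ ζ ^ suc (toℕ i) * q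
        ζʲ = trans (reflexive (cong (ζ ^_) (cong suc (≡.sym (ℕ.m+[n∸m]≡n (ℕ.<⇒≤ i<j))))))
                   (^-homo-* ζ (suc (toℕ i)) d)

      p≈0 : p ≈ 0#
      p≈0 = invertible-cancel (inverseOfDifference-inverseˡ 1#q) (begin
        p * (1# - q)     ≈⟨ distribˡ p 1# (- q) ⟩
        p * 1# + p * - q ≈⟨ +-cong (*-identityʳ p) (sym (-‿distribʳ-* p q)) ⟩
        p - p * q        ≈⟨ +-congʳ p≈pq ⟩
        p * q - p * q    ≈⟨ -‿inverseʳ (p * q) ⟩
        0#               ∎)

    -- Up to n this is Vieta with leading coefficient C(n+1, 1) = n + 1; beyond n both sides are
    -- zero.
    elementary-x : ∀ k → (suc n × 1#) * elementary x k ≈ (suc n C suc k) × 1#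
    elementary-x k with k ℕ.≤? n
    ... | yes k≤n = trans (*-congʳ (reflexive (cong (_× 1#) (≡.sym (nC1≡n (suc n))))))
                      (sym (vieta x x-separated binomials binomials-root k≤n))
    ... | no  k≰n = trans (*-congˡ (elementary-vanish x (ℕ.≰⇒> k≰n)))
                      (trans (zeroʳ _) (reflexive (cong (_× 1#) (≡.sym (k>n⇒nCk≡0 (s≤s (ℕ.≰⇒> k≰n)))))))

    𝒴-closedForm : ∀ m r → r ≤ m →
      (suc n × 1#) * ((suc r × 1#) * (suc n × 1#) * 𝒴 K prim (replicate r 2 ++ replicate (m ∸ r) 1))
        ≈ (suc n × 1#) * ((m C r) × 1# * ((n C m) × 1# + (- 1#) ^ r * ((n C (m ℕ.+ r ℕ.+ 1)) × 1#)))
    𝒴-closedForm m r r≤m = begin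
      ν * (κ * ν * 𝒴 K prim (twosOnes r (m ∸ r)))
        ≈⟨ *-congˡ (*-congˡ (trans (sumOver-↭ (𝔷 K prim) (distinctRearrangements↭words r (m ∸ r)))
             (trans (sumOver-cong (words r (m ∸ r)) (sumOver-increasingTuples x)) (sumOver-words x r (m ∸ r))))) ⟩
      ν * (κ * ν * quadratic x (m ∸ r) r)
        ≈⟨ quadratic-closedForm x elementary-x (m ∸ r) r ⟩
      rhs (m ∸ r ℕ.+ r)
        ≡⟨ cong rhs (ℕ.m∸n+n≡m r≤m) ⟩
      rhs m ∎
      where
      ν = suc n × 1#
      κ = suc r × 1#
      rhs : ℕ → Carrier
      rhs m = ν * ((m C r) × 1# * ((n C m) × 1# + (- 1#) ^ r * ((n C (m ℕ.+ r ℕ.+ 1)) × 1#)))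

  -- Division by integers in characteristic zero

  module _ (char0 : CharacteristicZero K) where

    reciprocal-inverseˡ : ∀ k .{{_ : NonZero k}} → reciprocal K char0 k * (k × 1#) ≈ 1#
    reciprocal-inverseˡ k = trans (*-congˡ (sym (trans (+-congˡ -0#≈0#) (+-identityʳ _))))
      (inverseOfDifference-inverseˡ (char0 k))

    reciprocal-unique : ∀ k .{{_ : NonZero k}} {y z} → (k × 1#) * y ≈ z → y ≈ reciprocal K char0 k * z
    reciprocal-unique k {y} {z} ky≈z = begin
      y                                      ≈⟨ *-identityˡ y ⟨
      1# * y                                 ≈⟨ *-congʳ (reciprocal-inverseˡ k) ⟨
      reciprocal K char0 k * (k × 1#) * y    ≈⟨ *-assoc _ _ _ ⟩
      reciprocal K char0 k * ((k × 1#) * y)  ≈⟨ *-congˡ ky≈z ⟩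
      reciprocal K char0 k * z               ∎

    fromℕ-cancelˡ : ∀ k .{{_ : NonZero k}} {y z} → (k × 1#) * y ≈ (k × 1#) * z → y ≈ z
    fromℕ-cancelˡ k ky≈kz = trans (reciprocal-unique k ky≈kz) (sym (reciprocal-unique k refl))

theorem6 : ∀ {c ℓ₁ ℓ₂} (K : HeytingField c ℓ₁ ℓ₂) (char0 : CharacteristicZero K) →
    let open HeytingField K in
    ∀ (n : ℕ) .{{_ : NonZero n}} {ζ : Carrier} (prim : IsPrimitiveRoot K n ζ) (m r : ℕ) → r ≤ m →
    𝒴 K prim (replicate r 2 ++ replicate (m ∸ r) 1)
    ≈ reciprocal K char0 (suc r ℕ.* n) {{m*n≢0 (suc r) n}} * fromℕ K (m C r)
    * (fromℕ K ((n ∸ 1) C m) + power K (- 1#) r * fromℕ K ((n ∸ 1) C (m ℕ.+ r ℕ.+ 1)))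
theorem6 K char0 (suc n) prim m r r≤m =
  trans (reciprocal-unique char0 (suc r ℕ.* suc n)
    -- The spare factor `suc n` kept by the ring identity is cancelled here.
    (trans (*-congʳ (×1-homo-* (suc r) (suc n))) (fromℕ-cancelˡ char0 (suc n) (𝒴-closedForm m r r≤m))))
    (sym (*-assoc _ _ _))
  where
  open HeytingField K using (heytingCommutativeRing; trans; sym; *-congʳ; *-assoc)
  open CommutativeRing (HeytingCommutativeRing.commutativeRing heytingCommutativeRing) using (semiring)
  open Algebra.Properties.Semiring.Mult semiring using (×1-homo-*)
  open HeytingFieldSums K
  open RootsOfUnity prim
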